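{- For every $\varepsilon\in(0,1)$ and $q\in\mathbb{N}$, there exists an integer $t_3=t_3(q,\varepsilon)$ such that for every integer $t\ge t_3$ and all $k_1,k_2,\dots,k_q\in\mathbb{N}$ satisfying $\sum_{j=1}^q k_j\le (2-\varepsilon)t$, there exists a $K_t$-minor-free graph $G$ that is not $\{k_1,k_2,\dots,k_q\}$-choosable.
   Context: $\mathbb{N}$ denotes the positive integers. All graphs are finite and simple. A graph is $K_t$-minor-free if $K_t$ cannot be obtained from a subgraph of it by contracting edges. A list assignment $L$ of a graph $G$ assigns to each vertex $v$ a set $L(v)$ of colours; an $L$-colouring is a proper colouring $f$ with $f(v)\in L(v)$ for all $v$. For a multiset $\lambda=\{k_1,\dots,k_q\}$ of positive integers, a $\lambda$-list assignment of $G$ is a list assignment $L$ such that the colour set $\bigcup_{v\in V(G)}L(v)$ can be partitioned into $q$ sets $C_1,\dots,C_q$ with $|L(v)\cap C_i|\ge k_i$ for every $i$ and every vertex $v$. $G$ is $\lambda$-choosable if $G$ is $L$-colourable for every $\lambda$-list assignment $L$. -}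

module Defs where

open import Algebra.Bundles using (CommutativeMonoid)
import Algebra.Properties.CommutativeSemigroup as CommutativeSemigroupProperties
open import Data.Fin.Base using (Fin)
open import Data.Fin.Properties using (_≟_)
open import Data.Integer.Base using (+_)
open import Data.Nat.Base as ℕ using (ℕ)
import Data.Nat.Properties as ℕ
open import Data.Product.Base using (Σ; ∃; ∃₂; _×_; _,_)
open import Data.Rational.Base as ℚ using (ℚ; 0ℚ; 1ℚ; ½; ∣_∣; 1/_; positive; nonNegative)
import Data.Rational.Properties as ℚ
open import Data.Sum.Base using (_⊎_)
open import Data.Vec.Base using (Vec; lookup)
open import Function.Bundles using (_⇔_)
open import Function.Definitions using (Injective; StrictlySurjective)
open import Level using (0ℓ)
open import Relation.Binary.Construct.Closure.ReflexiveTransitive using (Star)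
open import Relation.Binary.Core using (Rel)
open import Relation.Binary.Definitions using (Symmetric; Irreflexive; Decidable)
open import Relation.Binary.PropositionalEquality using (_≡_; _≢_; sym; trans; cong; cong₂; subst)
open import Relation.Nullary.Decidable using (¬?)
open import Relation.Nullary.Negation using (¬_)
open import Relation.Unary using (Pred; _∈_; _⊆_; _∩_; Empty)

-- Reals as Cauchy sequences of rationals.  Two sequences with the
-- same limit are not identified; _<ᴿ_ and _≤ᴿ_ depend only on the limits.

IsCauchy : (ℕ → ℚ) → Set
IsCauchy x = ∀ δ → 0ℚ ℚ.< δ →
  ∃ λ N → ∀ m n → N ℕ.≤ m → N ℕ.≤ n → ∣ x m ℚ.- x n ∣ ℚ.< δ

record ℝ : Set where
  constructor mkℝ
  field
    seq    : ℕ → ℚ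
    cauchy : IsCauchy seq

open ℝ public

infix  4 _<ᴿ_ _≤ᴿ_
infixl 6 _-ᴿ_
infixl 7 _*ᴿ_

_<ᴿ_ : ℝ → ℝ → Set
x <ᴿ y = ∃ λ δ → 0ℚ ℚ.< δ ×
  ∃ λ N → ∀ n → N ℕ.≤ n → seq x n ℚ.+ δ ℚ.≤ seq y n

_≤ᴿ_ : ℝ → ℝ → Set
x ≤ᴿ y = ¬ (y <ᴿ x)

fromℚ : ℚ → ℝ
fromℚ p = mkℝ (λ _ → p) λ δ 0<δ → 0 , λ _ _ _ _ →
  subst (λ z → ∣ z ∣ ℚ.< δ) (sym (ℚ.+-inverseʳ p)) 0<δ

fromℕ : ℕ → ℝ
fromℕ n = fromℚ (+ n ℚ./ 1)

private
  half-pos : ∀ {δ} → 0ℚ ℚ.< δ → 0ℚ ℚ.< ½ ℚ.* δ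
  half-pos {δ} 0<δ = ℚ.positive⁻¹ (½ ℚ.* δ) {{ℚ.pos*pos⇒pos ½ δ {{positive 0<δ}}}}

  halves : ∀ δ → ½ ℚ.* δ ℚ.+ ½ ℚ.* δ ≡ δ
  halves δ = trans (sym (ℚ.*-distribʳ-+ δ ½ ½)) (ℚ.*-identityˡ δ)

  ≤-⊔ˡ : ∀ {M N m} → M ℕ.⊔ N ℕ.≤ m → M ℕ.≤ m
  ≤-⊔ˡ {M} {N} = ℕ.≤-trans (ℕ.m≤m⊔n M N)

  ≤-⊔ʳ : ∀ {M N m} → M ℕ.⊔ N ℕ.≤ m → N ℕ.≤ m
  ≤-⊔ʳ {M} {N} = ℕ.≤-trans (ℕ.m≤n⊔m M N)

  interchange : ∀ a b c d → (a ℚ.+ b) ℚ.+ (c ℚ.+ d) ≡ (a ℚ.+ c) ℚ.+ (b ℚ.+ d)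
  interchange = CommutativeSemigroupProperties.interchange
    (CommutativeMonoid.commutativeSemigroup ℚ.+-0-commutativeMonoid)

  -‿cauchy : ∀ {x y} → IsCauchy x → IsCauchy y → IsCauchy (λ n → x n ℚ.- y n)
  -‿cauchy {x} {y} cx cy δ 0<δ with cx (½ ℚ.* δ) (half-pos 0<δ) | cy (½ ℚ.* δ) (half-pos 0<δ)
  ... | M , hx | N , hy = M ℕ.⊔ N , λ m n p q → begin-strict
    ∣ (x m ℚ.- y m) ℚ.- (x n ℚ.- y n) ∣          ≡⟨ cong ∣_∣ (rearrange (x m) (y m) (x n) (y n)) ⟩
    ∣ (x m ℚ.- x n) ℚ.- (y m ℚ.- y n) ∣          ≤⟨ ℚ.∣p-q∣≤∣p∣+∣q∣ (x m ℚ.- x n) (y m ℚ.- y n) ⟩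
    ∣ x m ℚ.- x n ∣ ℚ.+ ∣ y m ℚ.- y n ∣          <⟨ ℚ.+-mono-< (hx m n (≤-⊔ˡ p) (≤-⊔ˡ q)) (hy m n (≤-⊔ʳ {M} p) (≤-⊔ʳ {M} q)) ⟩
    ½ ℚ.* δ ℚ.+ ½ ℚ.* δ                          ≡⟨ halves δ ⟩
    δ                                            ∎
    where
    open ℚ.≤-Reasoning
    rearrange : ∀ a b c d → (a ℚ.- b) ℚ.- (c ℚ.- d) ≡ (a ℚ.- c) ℚ.- (b ℚ.- d)
    rearrange a b c d = trans (cong (a ℚ.- b ℚ.+_) (ℚ.neg-distrib-+ c (ℚ.- d)))
      (trans (interchange a (ℚ.- b) (ℚ.- c) (ℚ.- (ℚ.- d)))
             (cong (a ℚ.- c ℚ.+_) (sym (ℚ.neg-distrib-+ b (ℚ.- d)))))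

  eventually-bounded : ∀ {x} → IsCauchy x →
    ∃ λ B → 0ℚ ℚ.< B × ∃ λ N → ∀ n → N ℕ.≤ n → ∣ x n ∣ ℚ.≤ B
  eventually-bounded {x} cx with cx 1ℚ (ℚ.positive⁻¹ 1ℚ)
  ... | N , h = 1ℚ ℚ.+ ∣ x N ∣ , 0<B , N , λ n p → begin
    ∣ x n ∣                          ≡⟨ cong ∣_∣ (split (x n) (x N)) ⟩
    ∣ (x n ℚ.- x N) ℚ.+ x N ∣        ≤⟨ ℚ.∣p+q∣≤∣p∣+∣q∣ (x n ℚ.- x N) (x N) ⟩
    ∣ x n ℚ.- x N ∣ ℚ.+ ∣ x N ∣      ≤⟨ ℚ.+-monoˡ-≤ ∣ x N ∣ (ℚ.<⇒≤ (h n N p ℕ.≤-refl)) ⟩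
    1ℚ ℚ.+ ∣ x N ∣                   ∎
    where
    open ℚ.≤-Reasoning
    split : ∀ a b → a ≡ (a ℚ.- b) ℚ.+ b
    split a b = sym (trans (ℚ.+-assoc a (ℚ.- b) b)
      (trans (cong (a ℚ.+_) (ℚ.+-inverseˡ b)) (ℚ.+-identityʳ a)))
    0<B : 0ℚ ℚ.< 1ℚ ℚ.+ ∣ x N ∣
    0<B = ℚ.+-mono-<-≤ (ℚ.positive⁻¹ 1ℚ) (ℚ.0≤∣p∣ (x N))

  *-cauchy : ∀ {x y} → IsCauchy x → IsCauchy y → IsCauchy (λ n → x n ℚ.* y n)
  *-cauchy {x} {y} cx cy δ 0<δ with eventually-bounded {x} cx | eventually-bounded {y} cy
  ... | A , 0<A , K , bx | B , 0<B , L , by =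
    let M , hx = cx (η B 0<B) (0<η B 0<B)
        N , hy = cy (η A 0<A) (0<η A 0<A)
    in (K ℕ.⊔ L) ℕ.⊔ (M ℕ.⊔ N) , λ m n p q → begin-strict
    ∣ x m ℚ.* y m ℚ.- x n ℚ.* y n ∣
      ≡⟨ cong ∣_∣ (rearrange (x m) (y m) (x n) (y n)) ⟩
    ∣ x m ℚ.* (y m ℚ.- y n) ℚ.+ y n ℚ.* (x m ℚ.- x n) ∣
      ≤⟨ ℚ.∣p+q∣≤∣p∣+∣q∣ (x m ℚ.* (y m ℚ.- y n)) (y n ℚ.* (x m ℚ.- x n)) ⟩
    ∣ x m ℚ.* (y m ℚ.- y n) ∣ ℚ.+ ∣ y n ℚ.* (x m ℚ.- x n) ∣
      <⟨ ℚ.+-mono-<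
           (bound A 0<A (x m) (y m ℚ.- y n) (bx m (≤-⊔ˡ (≤-⊔ˡ p)))
             (hy m n (≤-⊔ʳ {M} (≤-⊔ʳ {K ℕ.⊔ L} p)) (≤-⊔ʳ {M} (≤-⊔ʳ {K ℕ.⊔ L} q))))
           (bound B 0<B (y n) (x m ℚ.- x n) (by n (≤-⊔ʳ {K} (≤-⊔ˡ q)))
             (hx m n (≤-⊔ˡ (≤-⊔ʳ {K ℕ.⊔ L} p)) (≤-⊔ˡ (≤-⊔ʳ {K ℕ.⊔ L} q)))) ⟩
    ½ ℚ.* δ ℚ.+ ½ ℚ.* δ
      ≡⟨ halves δ ⟩
    δ ∎
    where
    open ℚ.≤-Reasoning
    *-distribˡ-- : ∀ a b c → a ℚ.* (b ℚ.- c) ≡ a ℚ.* b ℚ.- a ℚ.* c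
    *-distribˡ-- a b c = trans (ℚ.*-distribˡ-+ a b (ℚ.- c))
      (cong (a ℚ.* b ℚ.+_) (sym (ℚ.neg-distribʳ-* a c)))

    telescope : ∀ a b c → (a ℚ.- b) ℚ.+ (b ℚ.- c) ≡ a ℚ.- c
    telescope a b c = trans (sym (ℚ.+-assoc (a ℚ.- b) b (ℚ.- c)))
      (cong (ℚ._- c) (trans (ℚ.+-assoc a (ℚ.- b) b)
        (trans (cong (a ℚ.+_) (ℚ.+-inverseˡ b)) (ℚ.+-identityʳ a))))

    rearrange : ∀ a b c d → a ℚ.* b ℚ.- c ℚ.* d ≡ a ℚ.* (b ℚ.- d) ℚ.+ d ℚ.* (a ℚ.- c)
    rearrange a b c d = sym (begin-equality
      a ℚ.* (b ℚ.- d) ℚ.+ d ℚ.* (a ℚ.- c)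
        ≡⟨ cong₂ ℚ._+_ (*-distribˡ-- a b d) (*-distribˡ-- d a c) ⟩
      (a ℚ.* b ℚ.- a ℚ.* d) ℚ.+ (d ℚ.* a ℚ.- d ℚ.* c)
        ≡⟨ cong₂ (λ p r → (a ℚ.* b ℚ.- a ℚ.* d) ℚ.+ (p ℚ.- r)) (ℚ.*-comm d a) (ℚ.*-comm d c) ⟩
      (a ℚ.* b ℚ.- a ℚ.* d) ℚ.+ (a ℚ.* d ℚ.- c ℚ.* d)
        ≡⟨ telescope (a ℚ.* b) (a ℚ.* d) (c ℚ.* d) ⟩
      a ℚ.* b ℚ.- c ℚ.* d ∎)

    inv : ∀ C → 0ℚ ℚ.< C → ℚ
    inv C 0<C = (1/ C) {{ℚ.pos⇒nonZero C {{positive 0<C}}}}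

    η : ∀ C → 0ℚ ℚ.< C → ℚ
    η C 0<C = inv C 0<C ℚ.* (½ ℚ.* δ)

    0<η : ∀ C (0<C : 0ℚ ℚ.< C) → 0ℚ ℚ.< η C 0<C
    0<η C 0<C = ℚ.positive⁻¹ (η C 0<C)
      {{ℚ.pos*pos⇒pos (inv C 0<C) {{ℚ.1/pos⇒pos C {{positive 0<C}}}}
                      (½ ℚ.* δ) {{positive (half-pos 0<δ)}}}}

    C*η : ∀ C (0<C : 0ℚ ℚ.< C) → C ℚ.* η C 0<C ≡ ½ ℚ.* δ
    C*η C 0<C = trans (sym (ℚ.*-assoc C (inv C 0<C) (½ ℚ.* δ)))
      (trans (cong (ℚ._* (½ ℚ.* δ)) (ℚ.*-inverseʳ C {{ℚ.pos⇒nonZero C {{positive 0<C}}}}))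
             (ℚ.*-identityˡ (½ ℚ.* δ)))

    bound : ∀ C (0<C : 0ℚ ℚ.< C) a d → ∣ a ∣ ℚ.≤ C → ∣ d ∣ ℚ.< η C 0<C → ∣ a ℚ.* d ∣ ℚ.< ½ ℚ.* δ
    bound C 0<C a d a≤C d<η = begin-strict
      ∣ a ℚ.* d ∣        ≡⟨ ℚ.∣p*q∣≡∣p∣*∣q∣ a d ⟩
      ∣ a ∣ ℚ.* ∣ d ∣    ≤⟨ ℚ.*-monoʳ-≤-nonNeg ∣ d ∣ {{nonNegative (ℚ.0≤∣p∣ d)}} a≤C ⟩
      C ℚ.* ∣ d ∣        <⟨ ℚ.*-monoʳ-<-pos C {{positive 0<C}} d<η ⟩
      C ℚ.* η C 0<C      ≡⟨ C*η C 0<C ⟩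
      ½ ℚ.* δ            ∎

_-ᴿ_ : ℝ → ℝ → ℝ
x -ᴿ y = mkℝ (λ n → seq x n ℚ.- seq y n) (-‿cauchy {seq x} {seq y} (cauchy x) (cauchy y))

_*ᴿ_ : ℝ → ℝ → ℝ
x *ᴿ y = mkℝ (λ n → seq x n ℚ.* seq y n) (*-cauchy {seq x} {seq y} (cauchy x) (cauchy y))

record Graph : Set₁ where
  field
    order      : ℕ
    Adj        : Rel (Fin order) 0ℓ
    adj-sym    : Symmetric Adj
    adj-irrefl : Irreflexive _≡_ Adj
    adj?       : Decidable Adj

  V : Set
  V = Fin order

open Graph public using (V; Adj)

K : ℕ → Graph
K t = record
  { order      = t
  ; Adj        = _≢_
  ; adj-sym    = λ i≢j j≡i → i≢j (sym j≡i)
  ; adj-irrefl = λ i≡j i≢j → i≢j i≡j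
  ; adj?       = λ i j → ¬? (i ≟ j)
  }

infix 4 _≅_ _⊑_ _↝_

record _≅_ (G H : Graph) : Set where
  field
    to         : V G → V H
    injective  : Injective _≡_ _≡_ to
    surjective : StrictlySurjective _≡_ to
    adj-iff    : ∀ u v → Adj G u v ⇔ Adj H (to u) (to v)

-- H ⊑ G : H is isomorphic to a (not necessarily induced) subgraph of G.
record _⊑_ (H G : Graph) : Set where
  field
    embed     : V H → V G
    injective : Injective _≡_ _≡_ embed
    adj-pres  : ∀ {u v} → Adj H u v → Adj G (embed u) (embed v)

-- G ↝ H : H is G / uv for some edge uv, up to isomorphism.  The map `quot`
-- identifies u with v and nothing else; the loop and any parallel edges
-- that arise are suppressed, so that H is again simple.
record _↝_ (G H : Graph) : Set where
  field
    u v        : V G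
    edge       : Adj G u v
    quot       : V G → V H
    surjective : StrictlySurjective _≡_ quot
    fibres     : ∀ x y → quot x ≡ quot y ⇔ (x ≡ y ⊎ (x ≡ u × y ≡ v) ⊎ (x ≡ v × y ≡ u))
    adj-iff    : ∀ a b → Adj H a b ⇔
                   (a ≢ b × ∃₂ λ x y → quot x ≡ a × quot y ≡ b × Adj G x y)

HasCliqueMinor : ℕ → Graph → Set₁
HasCliqueMinor t G = ∃₂ λ H H′ → H ⊑ G × Star _↝_ H H′ × H′ ≅ K t

CliqueMinorFree : ℕ → Graph → Set₁
CliqueMinorFree t G = ¬ HasCliqueMinor t G

ListAssignment : Graph → Set → Set₁
ListAssignment G C = V G → Pred C 0ℓ

module _ {C : Set} where

  record Colouring (G : Graph) (L : ListAssignment G C) : Set where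
    field
      colour  : V G → C
      inList  : ∀ v → colour v ∈ L v
      proper  : ∀ {u v} → Adj G u v → colour u ≢ colour v

  AtLeast : ℕ → Pred C 0ℓ → Set
  AtLeast k S = Σ (Fin k → C) λ f → Injective _≡_ _≡_ f × (∀ i → f i ∈ S)

  ColourSet : (G : Graph) → ListAssignment G C → Pred C 0ℓ
  ColourSet G L c = ∃ λ v → c ∈ L v

  -- Blocks are not required to be nonempty.  For positive kᵢ and a graph
  -- with at least one vertex, the size condition below forces it anyway.
  record IsPartition {q : ℕ} (S : Pred C 0ℓ) (P : Fin q → Pred C 0ℓ) : Set where
    field
      within   : ∀ i → P i ⊆ S
      covers   : ∀ {c} → c ∈ S → ∃ λ i → c ∈ P i
      disjoint : ∀ {i j} → i ≢ j → Empty (P i ∩ P j)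

  -- The multiset {k₁, …, k_q} is given as a vector; the order of its entries
  -- is immaterial, since the blocks can be permuted along with them.
  IsλListAssignment : ∀ {q} → Vec ℕ q → (G : Graph) → ListAssignment G C → Set₁
  IsλListAssignment {q} ks G L = Σ (Fin q → Pred C 0ℓ) λ P →
    IsPartition (ColourSet G L) P ×
    (∀ i v → AtLeast (lookup ks i) (L v ∩ P i))

Choosable : ∀ {q} → Vec ℕ q → Graph → Set₁
Choosable ks G = ∀ {C : Set} (L : ListAssignment G C) → IsλListAssignment ks G L → Colouring G L

{-# OPTIONS --safe #-}

-- Let A and B be cliques on n vertices, n slightly below t, and paste onto A
-- one copy of B for every colouring c of A.  The list of b in the copy for c
-- omits the colours c gives to the non-neighbours of b in A; if A is coloured by
-- c, the copy for c must avoid all n colours used on A, so fewer than 2n colours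
-- never suffice.  When every b has at most d non-neighbours in A, blocks of
-- kᵢ + d colours leave lists with kᵢ colours of the i-th block.
--
-- In a K_t-minor, the branch sets missing A all lie in one copy of B.  At least
-- t − n of the branch sets miss A and at least t − n miss that copy, so there
-- are linearly many small ones of each kind, pairwise joined by an edge between
-- A and B.  A random sparse bipartite graph of non-edges contains, for any two
-- such families, a full product X × Y of members, which excludes the minor.
-- Sparsity comes for free: colour the pairs in B × A randomly with a constant
-- number of colours and let the non-edges at b be those of its rarest colour.

module Submission where

open import Defs
import Algebra.Properties.CommutativeMonoid.Sum as MonoidSum
import Algebra.Properties.Semiring.Sum as SemiringSum
open import Data.Bool.Base using (Bool; true; false; _∧_)
open import Data.Empty using (⊥)
open import Data.Fin.Base using (Fin; zero; suc; punchIn; combine; remQuot; _↑ˡ_; _↑ʳ_; finToFun; funToFin; splitAt; join)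
import Data.Fin.Properties as Fin
import Data.Integer.Base as ℤ
import Data.Integer.Properties as ℤ
open import Data.Maybe.Base using (Maybe; just; nothing)
import Data.Maybe.Properties as Maybe
open import Data.Nat.Base using (ℕ; zero; suc; pred; NonZero; >-nonZero; >-nonZero⁻¹; _+_; _*_; _∸_; _^_; _≤_; _<_; z≤n; s≤s)
open import Data.Nat.DivMod using (_/_; m/n*n≤m; m*n/n≡m; /-monoˡ-≤; m≡m%n+[m/n]*n; m%n<n)
open import Data.Nat.Properties
open import Data.Nat.Tactic.RingSolver using (solve-∀)
open import Data.Product.Base using (Σ; ∃; ∃₂; _×_; _,_; proj₁; proj₂)
import Data.Product.Properties as Product
open import Data.Rational.Base as ℚ using (ℚ; 0ℚ; 1ℚ; mkℚ; toℚᵘ; fromℚᵘ)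
import Data.Rational.Properties as ℚ
open import Data.Rational.Solver using (module +-*-Solver)
open import Data.Rational.Unnormalised.Base as ℚᵘ using (mkℚᵘ; *≡*; *≤*)
import Data.Rational.Unnormalised.Properties as ℚᵘ
open import Data.Sum.Base using (_⊎_; inj₁; inj₂; [_,_]′; map₂)
import Data.Sum.Properties as Sum
open import Data.Unit.Base using (tt)
open import Data.Vec.Base using (Vec; []; _∷_; lookup; sum; map)
open import Data.Vec.Functional using (removeAt)
open import Data.Vec.Properties using (lookup-map)
open import Data.Vec.Relation.Unary.All using (All)
open import Function.Base using (_∘_; id; const)
open import Function.Bundles using (Equivalence)
open import Function.Definitions using (Injective)
open import Relation.Binary.Construct.Closure.ReflexiveTransitive using (Star; _◅_; _◅◅_) renaming (ε to stop)
open import Relation.Binary.PropositionalEquality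
open import Relation.Nullary.Decidable using (Dec; yes; no; does; ¬?; _×-dec_)
open import Relation.Nullary.Negation using (¬_; contradiction)
open import Relation.Unary using (_∩_)

open SemiringSum +-*-semiring
  using (∑-comm; ∑-distrib-+; *-distribˡ-sum; *-distribʳ-sum)
  renaming (sum to ∑; sum-cong-≗ to ∑-cong; sum-remove to ∑-remove)
open MonoidSum *-1-commutativeMonoid
  using ()
  renaming (sum to ∏; sum-cong-≗ to ∏-cong; sum-remove to ∏-remove)

-- Finite counting

∑-mono : ∀ {n} {f g : Fin n → ℕ} → (∀ i → f i ≤ g i) → ∑ f ≤ ∑ g
∑-mono {zero}  f≤g = z≤n
∑-mono {suc n} f≤g = +-mono-≤ (f≤g zero) (∑-mono (f≤g ∘ suc))

∑-const : ∀ n c → ∑ {n} (λ _ → c) ≡ n * c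
∑-const zero    c = refl
∑-const (suc n) c = cong (c +_) (∑-const n c)

∏-mono : ∀ {n} {f g : Fin n → ℕ} → (∀ i → f i ≤ g i) → ∏ f ≤ ∏ g
∏-mono {zero}  f≤g = ≤-refl
∏-mono {suc n} f≤g = *-mono-≤ (f≤g zero) (∏-mono (f≤g ∘ suc))

∏-const : ∀ n c → ∏ {n} (λ _ → c) ≡ c ^ n
∏-const zero    c = refl
∏-const (suc n) c = cong (c *_) (∏-const n c)

term≤∑ : ∀ {n} (f : Fin n → ℕ) i → f i ≤ ∑ f
term≤∑ f zero    = m≤m+n (f zero) _
term≤∑ f (suc i) = ≤-trans (term≤∑ (f ∘ suc) i) (m≤n+m _ (f zero))

∑-combine : ∀ a b (f : Fin (a * b) → ℕ) → ∑ f ≡ ∑ (λ i → ∑ (λ j → f (combine {a} i j)))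
∑-combine zero    b f = refl
∑-combine (suc a) b f = trans (∑-++ b (a * b) f)
  (cong (∑ (λ j → f (j ↑ˡ (a * b))) +_) (∑-combine a b (f ∘ (b ↑ʳ_))))
  where
  ∑-++ : ∀ m n (g : Fin (m + n) → ℕ) → ∑ g ≡ ∑ (λ i → g (i ↑ˡ n)) + ∑ (λ j → g (m ↑ʳ j))
  ∑-++ zero    n g = refl
  ∑-++ (suc m) n g = trans (cong (g zero +_) (∑-++ m n (g ∘ suc))) (sym (+-assoc (g zero) _ _))

some-term≤average : ∀ {k} (f : Fin (suc k) → ℕ) → ∃ λ i → suc k * f i ≤ ∑ f
some-term≤average {zero}  f = zero , ≤-refl
some-term≤average {suc k} f with some-term≤average (f ∘ suc)
... | i , h with f zero ≤? f (suc i)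
...   | yes p = zero , +-monoʳ-≤ (f zero) (≤-trans (*-monoʳ-≤ (suc k) p) h)
...   | no ¬p = suc i , +-mono-≤ (≰⇒≥ ¬p) h

⟦_⟧ : ∀ {A : Set} → Dec A → ℕ
⟦ yes _ ⟧ = 1
⟦ no _ ⟧  = 0

⟦⟧-mono : ∀ {A B : Set} → (A → B) → (a? : Dec A) (b? : Dec B) → ⟦ a? ⟧ ≤ ⟦ b? ⟧
⟦⟧-mono f (no _)  _       = z≤n
⟦⟧-mono f (yes a) (yes _) = ≤-refl
⟦⟧-mono f (yes a) (no ¬b) = contradiction (f a) ¬b

⟦⟧-× : ∀ {A B : Set} (a? : Dec A) (b? : Dec B) → ⟦ a? ×-dec b? ⟧ ≡ ⟦ a? ⟧ * ⟦ b? ⟧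
⟦⟧-× (yes _) (yes _) = refl
⟦⟧-× (yes _) (no _)  = refl
⟦⟧-× (no _)  _       = refl

count : ∀ {n} {P : Fin n → Set} → (∀ i → Dec (P i)) → ℕ
count P? = ∑ (λ i → ⟦ P? i ⟧)

count-mono : ∀ {n} {P Q : Fin n → Set} → (∀ i → P i → Q i) →
  (P? : ∀ i → Dec (P i)) (Q? : ∀ i → Dec (Q i)) → count P? ≤ count Q?
count-mono P⊆Q P? Q? = ∑-mono (λ i → ⟦⟧-mono (P⊆Q i) (P? i) (Q? i))

count-complement : ∀ {n} {P : Fin n → Set} (P? : ∀ i → Dec (P i)) →
  count P? + count (¬? ∘ P?) ≡ n
count-complement {n} P? = trans (sym (∑-distrib-+ (⟦_⟧ ∘ P?) (⟦_⟧ ∘ ¬? ∘ P?)))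
  (trans (∑-cong (one ∘ P?)) (trans (∑-const n 1) (*-identityʳ n)))
  where
  one : ∀ {A : Set} (a? : Dec A) → ⟦ a? ⟧ + ⟦ ¬? a? ⟧ ≡ 1
  one (yes _) = refl
  one (no _)  = refl

count-split : ∀ {n} {P Q : Fin n → Set} (P? : ∀ i → Dec (P i)) (Q? : ∀ i → Dec (Q i)) →
  count P? ≤ count Q? + count (λ i → P? i ×-dec ¬? (Q? i))
count-split P? Q? = ≤-trans (∑-mono (λ i → bound (P? i) (Q? i)))
  (≤-reflexive (∑-distrib-+ (⟦_⟧ ∘ Q?) _))
  where
  bound : ∀ {A B : Set} (a? : Dec A) (b? : Dec B) → ⟦ a? ⟧ ≤ ⟦ b? ⟧ + ⟦ a? ×-dec ¬? b? ⟧
  bound (no _)  _       = z≤n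
  bound (yes _) (yes _) = ≤-refl
  bound (yes _) (no _)  = ≤-refl

count-none : ∀ {n} {P : Fin n → Set} (P? : ∀ i → Dec (P i)) → (∀ i → ¬ P i) → count P? ≡ 0
count-none {zero}  P? none = refl
count-none {suc n} P? none with P? zero
... | yes p = contradiction p (none zero)
... | no _  = count-none (P? ∘ suc) (none ∘ suc)

count-unique : ∀ {n} {P : Fin n → Set} (P? : ∀ i → Dec (P i)) →
  (∀ i j → P i → P j → i ≡ j) → count P? ≤ 1
count-unique {zero}  P? uniq = z≤n
count-unique {suc n} P? uniq with P? zero
... | yes p = ≤-reflexive (cong suc (count-none (P? ∘ suc) (λ i q → 0≢suc (uniq zero (suc i) p q))))
  where
  0≢suc : ∀ {i : Fin n} → zero ≢ suc i
  0≢suc ()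
... | no _ = count-unique (P? ∘ suc) (λ i j p q → Fin.suc-injective (uniq (suc i) (suc j) p q))

choose : ∀ {n} {P : Fin n → Set} (P? : ∀ i → Dec (P i)) {s} → s ≤ count P? →
  Σ (Fin s → Fin n) λ f → Injective _≡_ _≡_ f × (∀ i → P (f i))
choose {zero}  P? z≤n = (λ ()) , (λ {}) , λ ()
choose {suc n} P? s≤ with P? zero
choose {suc n} P? {s} s≤ | no _ with choose (P? ∘ suc) s≤
... | f , inj , h = suc ∘ f , inj ∘ Fin.suc-injective , h
choose {suc n} P? {zero} s≤ | yes p = (λ ()) , (λ {}) , λ ()
choose {suc n} {P} P? {suc s} (s≤s s≤) | yes p with choose (P? ∘ suc) s≤
... | f , inj , h = g , g-inj , g∈P
  where
  g : Fin (suc s) → Fin (suc n)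
  g zero    = zero
  g (suc i) = suc (f i)
  g-inj : Injective _≡_ _≡_ g
  g-inj {zero}  {zero}  _  = refl
  g-inj {suc i} {suc j} eq = cong suc (inj (Fin.suc-injective eq))
  g∈P : ∀ i → P (g i)
  g∈P zero    = p
  g∈P (suc i) = h i

-- By rows, `R` has at least `m` pairs for each element of `P`; by columns, at most one for each
-- element of `Q`. With `m = 1` this compares cardinalities, with larger `m` it limits the number of
-- large classes.
double-count : ∀ {a b} {R : Fin a → Fin b → Set} (R? : ∀ x y → Dec (R x y))
  {P : Fin a → Set} (P? : ∀ x → Dec (P x)) {Q : Fin b → Set} (Q? : ∀ y → Dec (Q y)) m →
  (∀ x → P x → m ≤ count (R? x)) →
  (∀ x y → R x y → Q y) →
  (∀ {x x′} y → R x y → R x′ y → x ≡ x′) →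
  count P? * m ≤ count Q?
double-count {a} {b} {R} R? {P} P? {Q} Q? m large R⊆Q uniq = begin
  count P? * m                                 ≡⟨ *-distribʳ-sum m (λ x → ⟦ P? x ⟧) ⟩
  ∑ (λ x → ⟦ P? x ⟧ * m)                       ≤⟨ ∑-mono row ⟩
  ∑ (λ x → ∑ (λ y → ⟦ R? x y ⟧))               ≡⟨ ∑-comm (λ x y → ⟦ R? x y ⟧) ⟩
  ∑ (λ y → ∑ (λ x → ⟦ R? x y ⟧))               ≤⟨ ∑-mono col ⟩
  count Q?                                     ∎
  where
  open ≤-Reasoning
  row : ∀ x → ⟦ P? x ⟧ * m ≤ count (R? x)
  row x with P? x
  ... | yes p = ≤-trans (≤-reflexive (*-identityˡ m)) (large x p)
  ... | no _  = z≤n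
  col : ∀ y → count (λ x → R? x y) ≤ ⟦ Q? y ⟧
  col y with Q? y
  ... | yes _ = count-unique (λ x → R? x y) (λ x x′ → uniq y)
  ... | no ¬q = ≤-reflexive (count-none (λ x → R? x y) (λ x → ¬q ∘ R⊆Q x y))

0<count : ∀ {n} {P : Fin n → Set} (P? : ∀ i → Dec (P i)) i → P i → 1 ≤ count P?
0<count P? i p = ≤-trans (⟦⟧-mono (const p) (yes p) (P? i)) (term≤∑ (λ i → ⟦ P? i ⟧) i)

-- In the application `c` is the next entry of the pattern, and a single factor of the potential
-- depends on it.
∑∏-one-factor : ∀ {r K} (l₀ : Fin r) (g : Fin K → Fin r → ℕ) (f : Fin r → ℕ) →
  (∀ c l → l ≢ l₀ → g c l ≡ f l) → ∑ (λ c → g c l₀) ≡ K * f l₀ →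
  ∑ (λ c → ∏ (g c)) ≡ K * ∏ f
∑∏-one-factor {suc r} {K} l₀ g f same total = begin
  ∑ (λ c → ∏ (g c))                        ≡⟨ ∑-cong (λ c → ∏-remove {i = l₀} (g c)) ⟩
  ∑ (λ c → g c l₀ * ∏ (removeAt (g c) l₀)) ≡⟨ ∑-cong (λ c → cong (g c l₀ *_) (∏-cong (λ j → same c _ (Fin.punchInᵢ≢i l₀ j)))) ⟩
  ∑ (λ c → g c l₀ * ∏ (removeAt f l₀))     ≡⟨ *-distribʳ-sum (∏ (removeAt f l₀)) (λ c → g c l₀) ⟨
  ∑ (λ c → g c l₀) * ∏ (removeAt f l₀)     ≡⟨ cong (_* ∏ (removeAt f l₀)) total ⟩
  K * f l₀ * ∏ (removeAt f l₀)             ≡⟨ *-assoc K (f l₀) _ ⟩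
  K * (f l₀ * ∏ (removeAt f l₀))           ≡⟨ cong (K *_) (∏-remove {i = l₀} f) ⟨
  K * ∏ f                                  ∎
  where open ≡-Reasoning

-- A derandomised union bound

-- Classes of positions are given by a partial labelling, which makes them disjoint by construction;
-- `nothing` marks a position outside all classes.
size : ∀ {N r} → (Fin N → Maybe (Fin r)) → Fin r → ℕ
size ℓ l = count (λ e → Maybe.≡-dec Fin._≟_ (ℓ e) (just l))

Matches : ∀ {N r K} → (Fin N → Maybe (Fin r)) → (Fin N → Fin K) → (Fin N → Fin K) → Fin r → Set
Matches ℓ κ v l = ∀ e → ℓ e ≡ just l → v e ≡ κ e

module Hitting (k M r : ℕ) where

  private
    Λ = suc k

  -- For `p ≤ M`, this is `Λ ^ M` times the probability that a class with `p` entries still to be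
  -- drawn fails to match. The flag is `true` while all entries drawn so far agree.
  weight : Bool → ℕ → ℕ
  weight true  p = Λ ^ M ∸ Λ ^ (M ∸ p)
  weight false p = Λ ^ M

  kill : ∀ {A : Set} → Dec A → Bool → Bool → Bool
  kill (yes _) alive hit = alive ∧ hit
  kill (no _)  alive hit = alive

  -- Exactly one of the `Λ` values agrees with `κ₀`; the other `k` settle the class as failed. Thus
  -- the weight is a martingale.
  weight-average : ∀ b (κ₀ : Fin Λ) p → suc p ≤ M →
    ∑ (λ c → weight (b ∧ does (c Fin.≟ κ₀)) p) ≡ Λ * weight b (suc p)
  weight-average false κ₀ p p<M = ∑-const Λ (Λ ^ M)
  weight-average true  κ₀ p p<M = begin
    ∑ (λ c → weight (does (c Fin.≟ κ₀)) p)
      ≡⟨ ∑-remove {i = κ₀} (λ c → weight (does (c Fin.≟ κ₀)) p) ⟩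
    weight (does (κ₀ Fin.≟ κ₀)) p + ∑ (λ j → weight (does (punchIn κ₀ j Fin.≟ κ₀)) p)
      ≡⟨ cong₂ _+_ (here (κ₀ Fin.≟ κ₀)) (trans (∑-cong (λ j → there j (punchIn κ₀ j Fin.≟ κ₀))) (∑-const k (Λ ^ M))) ⟩
    (Λ ^ M ∸ Λ ^ (M ∸ p)) + k * Λ ^ M
      ≡⟨ +-comm (Λ ^ M ∸ Λ ^ (M ∸ p)) _ ⟩
    k * Λ ^ M + (Λ ^ M ∸ Λ ^ (M ∸ p))
      ≡⟨ +-∸-assoc (k * Λ ^ M) (^-monoʳ-≤ Λ (m∸n≤m M p)) ⟨
    k * Λ ^ M + Λ ^ M ∸ Λ ^ (M ∸ p)
      -- Since `p < M`, the truncated exponent `M ∸ p` is positive and a factor `Λ` splits off.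
      ≡⟨ cong₂ _∸_ (+-comm (k * Λ ^ M) (Λ ^ M)) (cong (Λ ^_) (sym (trans (cong suc (sym (pred[m∸n]≡m∸[1+n] M p))) (suc-pred (M ∸ p) {{>-nonZero (m<n⇒0<n∸m p<M)}})))) ⟩
    Λ * Λ ^ M ∸ Λ * Λ ^ (M ∸ suc p)
      ≡⟨ *-distribˡ-∸ Λ (Λ ^ M) (Λ ^ (M ∸ suc p)) ⟨
    Λ * (Λ ^ M ∸ Λ ^ (M ∸ suc p)) ∎
    where
    open ≡-Reasoning
    here : (d : Dec (κ₀ ≡ κ₀)) → weight (does d) p ≡ Λ ^ M ∸ Λ ^ (M ∸ p)
    here (yes _) = refl
    here (no ¬p) = contradiction refl ¬p
    there : ∀ j (d : Dec (punchIn κ₀ j ≡ κ₀)) → weight (does d) p ≡ Λ ^ M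
    there j (yes eq) = contradiction eq (Fin.punchInᵢ≢i κ₀ j)
    there j (no _)   = refl

  potential : ∀ {N} → (Fin N → Maybe (Fin r)) → (Fin r → Bool) → ℕ
  potential ℓ alive = ∏ (λ l → weight (alive l) (size ℓ l))

  update : Maybe (Fin r) → Fin Λ → (Fin r → Bool) → Fin Λ → Fin r → Bool
  update λ₀ κ₀ alive c l = kill (Maybe.≡-dec Fin._≟_ λ₀ (just l)) (alive l) (does (c Fin.≟ κ₀))

  -- Position zero carries at most one label, so drawing its entry changes at most one factor.
  potential-average : ∀ {N} (ℓ : Fin (suc N) → Maybe (Fin r)) κ₀ alive → (∀ l → size ℓ l ≤ M) →
    ∑ (λ c → potential (ℓ ∘ suc) (update (ℓ zero) κ₀ alive c)) ≡ Λ * potential ℓ alive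
  potential-average ℓ κ₀ alive small = cases (ℓ zero) refl
    where
    factor : Fin Λ → Fin r → ℕ
    factor c l = weight (update (ℓ zero) κ₀ alive c l) (size (ℓ ∘ suc) l)

    unaffected : ∀ c l → ℓ zero ≢ just l → factor c l ≡ weight (alive l) (size ℓ l)
    unaffected c l ≢l with Maybe.≡-dec Fin._≟_ (ℓ zero) (just l)
    ... | yes ≡l = contradiction ≡l ≢l
    ... | no _   = refl

    affected : ∀ l → ℓ zero ≡ just l → ∑ (λ c → factor c l) ≡ Λ * weight (alive l) (size ℓ l)
    affected l ≡l with Maybe.≡-dec Fin._≟_ (ℓ zero) (just l) | small l
    ... | yes _ | p<M = weight-average (alive l) κ₀ (size (ℓ ∘ suc) l) p<M
    ... | no ≢l | _   = contradiction ≡l ≢l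

    cases : ∀ λ₀ → ℓ zero ≡ λ₀ → ∑ (λ c → ∏ (factor c)) ≡ Λ * potential ℓ alive
    cases nothing eq = trans
      (∑-cong (λ c → ∏-cong (λ l → unaffected c l (λ eq′ → contradiction (trans (sym eq) eq′) λ ()))))
      (∑-const Λ (potential ℓ alive))
    cases (just l₀) eq = ∑∏-one-factor l₀ factor _
      (λ c l l≢ → unaffected c l (λ eq′ → l≢ (Maybe.just-injective (trans (sym eq′) eq))))
      (affected l₀ eq)

  -- Method of conditional expectations: potential ℓ alive / Λ ^ (M * r) is the
  -- probability that a uniformly random continuation matches no alive label.
  derandomise : ∀ {Z} N (ℓ : Fin Z → Fin N → Maybe (Fin r)) (κ : Fin Z → Fin N → Fin Λ)
    (alive : Fin Z → Fin r → Bool) → (∀ z l → size (ℓ z) l ≤ M) →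
    ∑ (λ z → potential (ℓ z) (alive z)) < (Λ ^ M) ^ r →
    Σ (Fin N → Fin Λ) λ v → ∀ z → ¬ (∀ l → alive z l ≡ true → ¬ Matches (ℓ z) (κ z) v l)
  -- With no entry left to draw, an alive class matches vacuously. If all classes fail, all are
  -- dead, and the potential at `z` alone reaches the bound.
  derandomise zero ℓ κ alive small Φ< = (λ ()) , λ z all-fail →
    <⇒≱ Φ< (≤-trans (≤-reflexive (sym (trans (∏-cong (λ l → dead z l (alive z l) refl (all-fail l))) (∏-const r (Λ ^ M)))))
                    (term≤∑ (λ z → potential (ℓ z) (alive z)) z))
    where
    dead : ∀ z l b → alive z l ≡ b → (alive z l ≡ true → ¬ Matches (ℓ z) (κ z) (λ ()) l) →
      weight (alive z l) 0 ≡ Λ ^ M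
    dead z l true  eq fail = contradiction (λ ()) (fail eq)
    dead z l false eq fail = cong (λ b → weight b 0) eq
  -- The first entry is fixed to a value whose total potential is at most the average, which is the
  -- present total.
  derandomise (suc N) ℓ κ alive small Φ< with some-term≤average Φ′
    where
    Φ′ : Fin Λ → ℕ
    Φ′ c = ∑ (λ z → potential (ℓ z ∘ suc) (update (ℓ z zero) (κ z zero) (alive z) c))
  ... | c , avg with derandomise N (λ z → ℓ z ∘ suc) (λ z → κ z ∘ suc)
                       (λ z → update (ℓ z zero) (κ z zero) (alive z) c)
                       (λ z l → ≤-trans (m≤n+m _ ⟦ Maybe.≡-dec Fin._≟_ (ℓ z zero) (just l) ⟧) (small z l))
                       (≤-<-trans (*-cancelˡ-≤ Λ (≤-trans avg (≤-reflexive total))) Φ<)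
    where
    total : ∑ (λ c → ∑ (λ z → potential (ℓ z ∘ suc) (update (ℓ z zero) (κ z zero) (alive z) c)))
          ≡ Λ * ∑ (λ z → potential (ℓ z) (alive z))
    total = trans (∑-comm (λ c z → potential (ℓ z ∘ suc) (update (ℓ z zero) (κ z zero) (alive z) c))) (trans (∑-cong (λ z → potential-average (ℓ z) (κ z zero) (alive z) (small z)))
      (sym (*-distribˡ-sum Λ (λ z → potential (ℓ z) (alive z)))))
  ... | v , hits = v⁺ , λ z all-fail → hits z (λ l alive′ → fail z l alive′ (all-fail l))
    where
    v⁺ : Fin (suc N) → Fin Λ
    v⁺ zero    = c
    v⁺ (suc e) = v e

    fail : ∀ z l → update (ℓ z zero) (κ z zero) (alive z) c l ≡ true →
      (alive z l ≡ true → ¬ Matches (ℓ z) (κ z) v⁺ l) → ¬ Matches (ℓ z ∘ suc) (κ z ∘ suc) v l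
    fail z l alive′ h matches with Maybe.≡-dec Fin._≟_ (ℓ z zero) (just l) | alive z l | c Fin.≟ κ z zero
    ... | no ≢l | true | _      = h refl λ { zero ≡l → contradiction ≡l ≢l ; (suc e) → matches e }
    ... | yes _ | true | yes eq = h refl λ { zero _ → eq ; (suc e) → matches e }

  -- A class of at most `M` entries is missed with probability at most `1 - 1 / Λ ^ M`, and disjoint
  -- classes are independent. So the hypothesis says that fewer than one index is expected to miss
  -- all its classes.
  hit-all : ∀ {Z N} (ℓ : Fin Z → Fin N → Maybe (Fin r)) (κ : Fin Z → Fin N → Fin Λ) →
    Z * (Λ ^ M ∸ 1) ^ r < (Λ ^ M) ^ r →
    Σ (Fin N → Fin Λ) λ v → ∀ z → (∀ l → size (ℓ z) l ≤ M) → ¬ (∀ l → ¬ Matches (ℓ z) (κ z) v l)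
  hit-all {Z} {N} ℓ κ Z< =
    let v , hits = derandomise N (λ z → clip (ℓ z) (small? z)) κ (λ _ _ → true)
                     (λ z → clip-small (small? z)) bound
    in v , λ z small fails → hits z (λ l _ → clip-fails (small? z) small (fails l))
    where
    small? : ∀ z → Dec (∀ l → size (ℓ z) l ≤ M)
    small? z = Fin.all? (λ l → size (ℓ z) l ≤? M)

    -- Indices with an oversized class get the empty labelling, so that `derandomise` applies to all
    -- `z` at once.
    clip : ∀ {A : Set} → (Fin N → Maybe (Fin r)) → Dec A → Fin N → Maybe (Fin r)
    clip ℓ (yes _) = ℓ
    clip ℓ (no _)  = const nothing

    clip-small : ∀ {ℓ} (d : Dec (∀ l → size ℓ l ≤ M)) → ∀ l → size (clip ℓ d) l ≤ M
    clip-small (yes small) = small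
    clip-small (no _) l = ≤-trans (≤-reflexive (count-none {N} (λ _ → Maybe.≡-dec Fin._≟_ nothing (just l)) (λ _ ()))) z≤n

    clip-fails : ∀ {ℓ κ v l} {A : Set} (d : Dec A) → A → ¬ Matches ℓ κ v l → ¬ Matches {K = Λ} (clip ℓ d) κ v l
    clip-fails (yes _) a fail = fail
    clip-fails (no ¬a) a fail = contradiction a ¬a

    bound : ∑ (λ z → potential (clip (ℓ z) (small? z)) (λ _ → true)) < (Λ ^ M) ^ r
    bound = ≤-<-trans
      (≤-trans (∑-mono (λ z → ≤-trans
                 (∏-mono (λ l → ∸-monoʳ-≤ (Λ ^ M) (m^n>0 Λ (M ∸ size (clip (ℓ z) (small? z)) l))))
                 (≤-reflexive (∏-const r (Λ ^ M ∸ 1)))))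
               (≤-reflexive (∑-const Z ((Λ ^ M ∸ 1) ^ r))))
      Z<

-- Growth estimates

-- These are the two leading terms of the binomial expansion.
bernoulli : ∀ Q p → Q ^ suc p + suc p * Q ^ p ≤ suc Q ^ suc p
bernoulli Q zero    = ≤-reflexive (base Q)
  where
  base : ∀ Q → Q * 1 + 1 ≡ suc Q * 1
  base = solve-∀
bernoulli Q (suc p) = begin
  Q * (Q * X) + suc (suc p) * (Q * X)              ≤⟨ m≤m+n _ (suc p * X) ⟩
  Q * (Q * X) + suc (suc p) * (Q * X) + suc p * X  ≡⟨ expand Q p X ⟩
  suc Q * (Q * X + suc p * X)                      ≤⟨ *-monoʳ-≤ (suc Q) (bernoulli Q p) ⟩
  suc Q * suc Q ^ suc p                            ∎
  where
  open ≤-Reasoning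
  X = Q ^ p
  expand : ∀ Q p X → Q * (Q * X) + suc (suc p) * (Q * X) + suc p * X ≡ suc Q * (Q * X + suc p * X)
  expand = solve-∀

-- By `bernoulli`, each run of `suc Q` factors gains at least a factor 2 when `Q` grows to `suc Q`,
-- and there is room for `w` runs.
2^w*Q^r≤[1+Q]^r : ∀ Q w r → suc Q * w ≤ r → 2 ^ w * Q ^ r ≤ suc Q ^ r
2^w*Q^r≤[1+Q]^r Q zero    r h = ≤-trans (≤-reflexive (*-identityˡ (Q ^ r))) (^-monoˡ-≤ r (n≤1+n Q))
2^w*Q^r≤[1+Q]^r Q (suc w) r h
  with r′ , refl ← m≤n⇒∃[o]m+o≡n (≤-trans (≤-trans (m≤m+n (suc Q) (suc Q * w)) (≤-reflexive (sym (*-suc (suc Q) w)))) h) = begin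
  2 * 2 ^ w * Q ^ (suc Q + r′)            ≡⟨ cong (2 * 2 ^ w *_) (^-distribˡ-+-* Q (suc Q) r′) ⟩
  2 * 2 ^ w * (Q ^ suc Q * Q ^ r′)        ≡⟨ shuffle (2 ^ w) (Q ^ suc Q) (Q ^ r′) ⟩
  (Q ^ suc Q + Q ^ suc Q) * (2 ^ w * Q ^ r′)
    ≤⟨ *-mono-≤ (≤-trans (+-monoʳ-≤ (Q ^ suc Q) (m≤n+m (Q * Q ^ Q) (Q ^ Q))) (bernoulli Q Q))
                (2^w*Q^r≤[1+Q]^r Q w r′ (+-cancelˡ-≤ (suc Q) _ _ (≤-trans (≤-reflexive (sym (*-suc (suc Q) w))) h))) ⟩
  suc Q ^ suc Q * suc Q ^ r′              ≡⟨ ^-distribˡ-+-* (suc Q) (suc Q) r′ ⟨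
  suc Q ^ (suc Q + r′)                    ∎
  where
  open ≤-Reasoning
  shuffle : ∀ a b c → 2 * a * (b * c) ≡ (b + b) * (a * c)
  shuffle = solve-∀

n<2^n : ∀ n → n < 2 ^ n
n<2^n zero    = s≤s z≤n
n<2^n (suc n) = ≤-trans (+-mono-≤ (m^n>0 2 n) (n<2^n n)) (≤-reflexive (cong (2 ^ n +_) (sym (+-identityʳ (2 ^ n)))))

-- Each increment of `L` doubles the right side and at most doubles the left. The base case
-- `L = 2 * D + 2` uses `n < 2 ^ n` for `D` and `suc D`.
linear≤exponential : ∀ D L → 2 * D + 2 ≤ L → D * suc L ≤ 2 ^ L
linear≤exponential D L h with o , refl ← m≤n⇒∃[o]m+o≡n h = go o
  where
  open ≤-Reasoning
  go : ∀ o → D * suc (2 * D + 2 + o) ≤ 2 ^ (2 * D + 2 + o)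
  go zero = begin
    D * suc (2 * D + 2 + 0)         ≤⟨ m≤m+n _ D ⟩
    D * suc (2 * D + 2 + 0) + D     ≡⟨ arith D ⟩
    2 * (D * suc (suc D))           ≤⟨ *-monoʳ-≤ 2 (*-mono-≤ (<⇒≤ (n<2^n D)) (n<2^n (suc D))) ⟩
    2 * (2 ^ D * 2 ^ suc D)         ≡⟨ cong (2 *_) (^-distribˡ-+-* 2 D (suc D)) ⟨
    2 ^ suc (D + suc D)             ≡⟨ cong (2 ^_) (exponent D) ⟩
    2 ^ (2 * D + 2 + 0)             ∎
    where
    arith : ∀ D → D * suc (2 * D + 2 + 0) + D ≡ 2 * (D * suc (suc D))
    arith = solve-∀
    exponent : ∀ D → suc (D + suc D) ≡ 2 * D + 2 + 0
    exponent = solve-∀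
  go (suc o) = begin
    D * suc (X + suc o)                    ≤⟨ *-monoʳ-≤ D (s≤s (≤-trans (≤-reflexive (+-suc X o)) (m≤n+m _ (X + o)))) ⟩
    D * (suc (X + o) + suc (X + o))        ≡⟨ double D (suc (X + o)) ⟩
    2 * (D * suc (X + o))                  ≤⟨ *-monoʳ-≤ 2 (go o) ⟩
    2 ^ suc (X + o)                        ≡⟨ cong (2 ^_) (+-suc X o) ⟨
    2 ^ (X + suc o)                        ∎
    where
    X = 2 * D + 2
    double : ∀ D x → D * (x + x) ≡ 2 * (D * x)
    double = solve-∀

binary-length : ∀ s → 1 ≤ s → ∃ λ L → s < 2 ^ L × 2 ^ L ≤ 2 * s
binary-length (suc zero)    _ = 1 , ≤-refl , ≤-refl
binary-length (suc (suc s)) _ with binary-length (suc s) (s≤s z≤n)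
... | L , lo , hi with suc (suc s) <? 2 ^ L
...   | yes p = L , p , ≤-trans hi (*-monoʳ-≤ 2 (n≤1+n (suc s)))
...   | no ¬p = suc L , ≤-trans (s≤s lo) (≤-trans (+-monoˡ-≤ (2 ^ L) (m^n>0 2 L)) (+-monoʳ-≤ (2 ^ L) (m≤m+n (2 ^ L) 0)))
                      , *-monoʳ-≤ 2 (≮⇒≥ ¬p)

-- The threshold forces `L` into the range where the exponential bound holds for `2 * D`; the
-- doubling pays for `2 ^ L ≤ 2 * s`.
logarithm≤linear : ∀ D s → 2 ^ (2 * (2 * D) + 2) ≤ s → ∃ λ L → s < 2 ^ L × D * suc L ≤ s
logarithm≤linear D s h with binary-length s (≤-trans (m^n>0 2 (2 * (2 * D) + 2)) h)
... | L , lo , hi = L , lo , *-cancelˡ-≤ 2 (≤-trans (≤-reflexive (sym (*-assoc 2 D (suc L))))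
        (≤-trans (linear≤exponential (2 * D) L (<⇒≤ (≰⇒> large))) hi))
  where
  large : ¬ (L ≤ 2 * (2 * D) + 2)
  large L≤ = <⇒≱ lo (≤-trans (^-monoʳ-≤ 2 L≤) h)

-- K ^ n * (suc s ^ n * suc s ^ n) is the number of triples (κ , η , ξ) in
-- unavoidable-pattern, and 1 - 1/P bounds the probability that a given pair of
-- classes is not matched.
union-bound : ∀ K P c → 2 ≤ P → ∃ λ s₀ → ∀ s → s₀ ≤ s → ∀ n → n ≤ c * s →
  K ^ n * (suc s ^ n * suc s ^ n) * (P ∸ 1) ^ (s * s) < P ^ (s * s)
union-bound K P@(suc (suc Q)) c (s≤s (s≤s z≤n)) = 2 ^ (2 * (2 * D) + 2) , bound
  where
  -- The logarithm of the number of triples is of order `s log s`, against `s * s` pairs; this `D`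
  -- makes `log s` a small enough fraction of `s`.
  D = P * suc (c * (K + 2))

  bound : ∀ s → 2 ^ (2 * (2 * D) + 2) ≤ s → ∀ n → n ≤ c * s →
    K ^ n * (suc s ^ n * suc s ^ n) * suc Q ^ (s * s) < P ^ (s * s)
  bound s s₀≤s n n≤cs with L , s<2^L , D[1+L]≤s ← logarithm≤linear D s s₀≤s = begin-strict
    K ^ n * (suc s ^ n * suc s ^ n) * suc Q ^ (s * s)  <⟨ *-monoˡ-< (suc Q ^ (s * s)) {{m^n≢0 (suc Q) (s * s)}} Z<2^w ⟩
    2 ^ w * suc Q ^ (s * s)                             ≤⟨ 2^w*Q^r≤[1+Q]^r (suc Q) w (s * s) Pw≤ ⟩
    P ^ (s * s)                                         ∎
    where
    open ≤-Reasoning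
    -- A bound for the binary logarithm of the number of triples, plus one for strictness.
    w = suc (n * (K + (L + L)))

    pow : ∀ {x} y → x ≤ 2 ^ y → x ^ n ≤ 2 ^ (y * n)
    pow y x≤ = ≤-trans (^-monoˡ-≤ n x≤) (≤-reflexive (^-*-assoc 2 y n))

    exponent : ∀ n K L → K * n + (L * n + L * n) ≡ n * (K + (L + L))
    exponent = solve-∀

    Z<2^w : K ^ n * (suc s ^ n * suc s ^ n) < 2 ^ w
    Z<2^w = begin-strict
      K ^ n * (suc s ^ n * suc s ^ n)          ≤⟨ *-mono-≤ (pow K (<⇒≤ (n<2^n K))) (*-mono-≤ (pow L s<2^L) (pow L s<2^L)) ⟩
      2 ^ (K * n) * (2 ^ (L * n) * 2 ^ (L * n)) ≡⟨ cong (2 ^ (K * n) *_) (^-distribˡ-+-* 2 (L * n) (L * n)) ⟨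
      2 ^ (K * n) * 2 ^ (L * n + L * n)        ≡⟨ ^-distribˡ-+-* 2 (K * n) (L * n + L * n) ⟨
      2 ^ (K * n + (L * n + L * n))            ≡⟨ cong (2 ^_) (exponent n K L) ⟩
      2 ^ (n * (K + (L + L)))                  <⟨ ^-monoʳ-< 2 ≤-refl (n<1+n (n * (K + (L + L)))) ⟩
      2 ^ w                                    ∎

    1≤s : 1 ≤ s
    1≤s = ≤-trans (m^n>0 2 (2 * (2 * D) + 2)) s₀≤s

    slack : ∀ p c s K L → p * (s + c * s * (K + (L + L))) + p * (s * L + c * s * K * L + 2 * c * s) ≡ s * (p * suc (c * (K + 2)) * suc L)
    slack = solve-∀

    Pw≤ : P * w ≤ s * s
    Pw≤ = begin
      P * w                              ≤⟨ *-monoʳ-≤ (suc (suc Q)) (+-mono-≤ 1≤s (*-monoˡ-≤ (K + (L + L)) n≤cs)) ⟩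
      P * (s + c * s * (K + (L + L)))    ≤⟨ m≤m+n _ _ ⟩
      _                                            ≡⟨ slack P c s K L ⟩
      s * (D * suc L)                              ≤⟨ *-monoʳ-≤ s D[1+L]≤s ⟩
      s * s                                        ∎

-- A bipartite pattern that no two families of small disjoint sets avoid

pairLabel : ∀ {s} → Fin (suc s) → Fin (suc s) → Maybe (Fin (s * s))
pairLabel (suc j) (suc i) = just (combine j i)
pairLabel (suc j) zero    = nothing
pairLabel zero    _       = nothing

pairLabel-just : ∀ {s} b a (j i : Fin s) → pairLabel b a ≡ just (combine j i) → b ≡ suc j × a ≡ suc i
pairLabel-just (suc j′) (suc i′) j i eq
  with refl , refl ← Fin.combine-injective j′ i′ j i (Maybe.just-injective eq) = refl , refl

-- In a labelling with values in Fin (suc s) the label zero means “in no set”.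
classSize : ∀ {n s} → (Fin n → Fin (suc s)) → Fin s → ℕ
classSize ξ i = count (λ x → ξ x Fin.≟ suc i)

-- Products of an `η`-class and a `ξ`-class are disjoint and have at most `m * m` positions, so
-- `hit-all` applies with one index per triple. Covering every `κ` allows it to be chosen after `v`,
-- as the rarest value in each row.
unavoidable-pattern : ∀ k m s n →
  suc k ^ n * (suc s ^ n * suc s ^ n) * (suc k ^ (m * m) ∸ 1) ^ (s * s) < (suc k ^ (m * m)) ^ (s * s) →
  Σ (Fin n → Fin n → Fin (suc k)) λ v → ∀ (κ : Fin n → Fin (suc k)) (η ξ : Fin n → Fin (suc s)) →
    (∀ j → classSize η j ≤ m) → (∀ i → classSize ξ i ≤ m) →
    ¬ (∀ j i → ¬ (∀ y x → η y ≡ suc j → ξ x ≡ suc i → v y x ≡ κ y))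
unavoidable-pattern k m s n Z< =
  let w , hits = hit-all ℓ κ′ Z<
  in (λ y x → w (combine y x)) , λ κ η ξ η-small ξ-small fails →
     let z = encode κ η ξ in
     hits z (λ l → size-bound κ η ξ η-small ξ-small l)
       (λ l matches → let j , i = remQuot {s} s l in
         fails j i (λ y x ηy ξx → trans
           (matches (combine y x) (trans (ℓ-encode κ η ξ y x) (trans (cong₂ pairLabel ηy ξx) (cong just (Fin.combine-remQuot {s} s l)))))
           (κ-encode κ η ξ y x)))
  where
  open Hitting k (m * m) (s * s)
  Λ = suc k
  F = Fin n → Fin (suc s)
  Z = Λ ^ n * (suc s ^ n * suc s ^ n)

  encode : (Fin n → Fin Λ) → F → F → Fin Z
  encode κ η ξ = combine (funToFin κ) (combine (funToFin η) (funToFin ξ))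

  decodeκ : Fin Z → Fin n → Fin Λ
  decodeκ z = finToFun (proj₁ (remQuot {Λ ^ n} (suc s ^ n * suc s ^ n) z))

  rest : Fin Z → Fin (suc s ^ n) × Fin (suc s ^ n)
  rest z = remQuot {suc s ^ n} (suc s ^ n) (proj₂ (remQuot {Λ ^ n} (suc s ^ n * suc s ^ n) z))

  κ′ : Fin Z → Fin (n * n) → Fin Λ
  κ′ z e = decodeκ z (proj₁ (remQuot {n} n e))

  ℓ : Fin Z → Fin (n * n) → Maybe (Fin (s * s))
  ℓ z e = pairLabel (finToFun (proj₁ (rest z)) (proj₁ (remQuot {n} n e)))
                    (finToFun (proj₂ (rest z)) (proj₂ (remQuot {n} n e)))

  decode-encode : ∀ κ η ξ → remQuot {Λ ^ n} (suc s ^ n * suc s ^ n) (encode κ η ξ) ≡ (funToFin κ , combine (funToFin η) (funToFin ξ))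
  decode-encode κ η ξ = Fin.remQuot-combine (funToFin κ) _

  rest-encode : ∀ κ η ξ → rest (encode κ η ξ) ≡ (funToFin η , funToFin ξ)
  rest-encode κ η ξ = trans (cong (remQuot {suc s ^ n} (suc s ^ n) ∘ proj₂) (decode-encode κ η ξ))
    (Fin.remQuot-combine (funToFin η) (funToFin ξ))

  κ-encode : ∀ κ η ξ y x → κ′ (encode κ η ξ) (combine y x) ≡ κ y
  κ-encode κ η ξ y x = trans
    (cong₂ (λ p e → finToFun (proj₁ p) (proj₁ e)) (decode-encode κ η ξ) (Fin.remQuot-combine y x))
    (Fin.finToFun-funToFin κ y)

  ℓ-encode : ∀ κ η ξ y x → ℓ (encode κ η ξ) (combine y x) ≡ pairLabel (η y) (ξ x)
  ℓ-encode κ η ξ y x = trans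
    (cong₂ (λ p e → pairLabel (finToFun (proj₁ p) (proj₁ e)) (finToFun (proj₂ p) (proj₂ e)))
      (rest-encode κ η ξ) (Fin.remQuot-combine y x))
    (cong₂ pairLabel (Fin.finToFun-funToFin η y) (Fin.finToFun-funToFin ξ x))

  size-bound : ∀ κ η ξ → (∀ j → classSize η j ≤ m) → (∀ i → classSize ξ i ≤ m) →
    ∀ l → size (ℓ (encode κ η ξ)) l ≤ m * m
  size-bound κ η ξ η-small ξ-small l with j , i , refl ← Fin.combine-surjective {s} {s} l = begin
    size (ℓ z) (combine j i)
      ≡⟨ ∑-combine n n _ ⟩
    ∑ (λ y → ∑ (λ x → ⟦ ℓ? y x ⟧))
      ≤⟨ ∑-mono (λ y → ∑-mono (λ x → ≤-trans
           (⟦⟧-mono (pairLabel-just (η y) (ξ x) j i ∘ trans (sym (ℓ-encode κ η ξ y x))) (ℓ? y x) ((η y Fin.≟ suc j) ×-dec (ξ x Fin.≟ suc i)))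
           (≤-reflexive (⟦⟧-× (η y Fin.≟ suc j) (ξ x Fin.≟ suc i))))) ⟩
    ∑ (λ y → ∑ (λ x → ⟦ η y Fin.≟ suc j ⟧ * ⟦ ξ x Fin.≟ suc i ⟧))
      ≡⟨ ∑-cong (λ y → sym (*-distribˡ-sum ⟦ η y Fin.≟ suc j ⟧ (λ x → ⟦ ξ x Fin.≟ suc i ⟧))) ⟩
    ∑ (λ y → ⟦ η y Fin.≟ suc j ⟧ * classSize ξ i)
      ≡⟨ *-distribʳ-sum (classSize ξ i) (λ y → ⟦ η y Fin.≟ suc j ⟧) ⟨
    classSize η j * classSize ξ i
      ≤⟨ *-mono-≤ (η-small j) (ξ-small i) ⟩
    m * m ∎
    where
    open ≤-Reasoning
    z = encode κ η ξ
    ℓ? : ∀ y x → Dec (ℓ z (combine y x) ≡ just (combine j i))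
    ℓ? y x = Maybe.≡-dec Fin._≟_ (ℓ z (combine y x)) (just (combine j i))

rare-value : ∀ {n k} (f : Fin n → Fin (suc k)) → ∃ λ κ → suc k * count (λ x → f x Fin.≟ κ) ≤ n
rare-value {n} {k} f with some-term≤average (λ κ → count (λ x → f x Fin.≟ κ))
... | κ , avg = κ , ≤-trans avg (begin
  ∑ (λ κ → ∑ (λ x → ⟦ f x Fin.≟ κ ⟧))  ≡⟨ ∑-comm (λ κ x → ⟦ f x Fin.≟ κ ⟧) ⟩
  ∑ (λ x → count (λ κ → f x Fin.≟ κ))  ≤⟨ ∑-mono (λ x → count-unique (λ κ → f x Fin.≟ κ) (λ _ _ p q → trans (sym p) q)) ⟩
  ∑ {n} (λ _ → 1)                      ≡⟨ ∑-const n 1 ⟩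
  n * 1                                ≡⟨ *-identityʳ n ⟩
  n                                    ∎)
  where open ≤-Reasoning

-- Branch sets of a clique minor

-- The branch sets are the fibres of `branch`. They cover all of `H`, because deletions take place
-- before `H` is reached and only contractions follow.
record CliqueModel (t : ℕ) (H : Graph) : Set where
  field
    branch    : V H → Fin t
    nonempty  : ∀ i → ∃ λ x → branch x ≡ i
    connected : ∀ {x y} → branch x ≡ branch y → Star (λ a b → Adj H a b × branch a ≡ branch b) x y
    adjacent  : ∀ {i j} → i ≢ j → ∃₂ λ x y → branch x ≡ i × branch y ≡ j × Adj H x y

module _ where
  open Equivalence using (to; from)

  iso⇒model : ∀ {t H} → H ≅ K t → CliqueModel t H
  iso⇒model {t} {H} iso = record
    { branch    = I.to
    ; nonempty  = I.surjective
    ; connected = λ eq → subst (Star _ _) (I.injective eq) stop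
    ; adjacent  = λ {i} {j} i≢j →
        let x , x≡ = I.surjective i
            y , y≡ = I.surjective j
        in x , y , x≡ , y≡ , from (I.adj-iff x y) (λ eq → i≢j (trans (sym x≡) (trans eq y≡)))
    }
    where module I = _≅_ iso

  contraction-model : ∀ {t G H} → G ↝ H → CliqueModel t H → CliqueModel t G
  contraction-model {t} {G} {H} con model = record
    { branch    = branch
    ; nonempty  = λ i → let a , a≡ = M.nonempty i
                            x , x≡ = C.surjective a
                        in x , trans (cong M.branch x≡) a≡
    ; connected = λ eq → lift refl refl (M.connected eq)
    ; adjacent  = λ i≢j →
        let a , b , a≡ , b≡ , ab = M.adjacent i≢j
            _ , x , y , x≡ , y≡ , xy = to (C.adj-iff a b) ab
        in x , y , trans (cong M.branch x≡) a≡ , trans (cong M.branch y≡) b≡ , xy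
    }
    where
    module C = _↝_ con
    module M = CliqueModel model
    branch : V G → Fin t
    branch = M.branch ∘ C.quot

    Step : V G → V G → Set
    Step x y = Adj G x y × branch x ≡ branch y

    fibre : ∀ {x y} → C.quot x ≡ C.quot y → Star Step x y
    fibre {x} {y} eq with to (C.fibres x y) eq
    ... | inj₁ refl                 = stop
    ... | inj₂ (inj₁ (refl , refl)) = (C.edge , cong M.branch eq) ◅ stop
    ... | inj₂ (inj₂ (refl , refl)) = (Graph.adj-sym G C.edge , cong M.branch eq) ◅ stop

    -- A path lifts edge by edge; consecutive lifted edges meet in a common fibre, which is a point
    -- or the contracted edge.
    lift : ∀ {x y a b} → C.quot x ≡ a → C.quot y ≡ b →
      Star (λ a b → Adj H a b × M.branch a ≡ M.branch b) a b → Star Step x y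
    lift x≡ y≡ stop = fibre (trans x≡ (sym y≡))
    lift x≡ y≡ (_◅_ {a} {c} (ac , same) path) with to (C.adj-iff a c) ac
    ... | _ , x′ , z , x′≡ , z≡ , x′z =
      fibre (trans x≡ (sym x′≡)) ◅◅
      ((x′z , trans (cong M.branch x′≡) (trans same (cong M.branch (sym z≡)))) ◅ lift z≡ y≡ path)

  minor⇒model : ∀ {t H H′} → Star _↝_ H H′ → H′ ≅ K t → CliqueModel t H
  minor⇒model stop             iso = iso⇒model iso
  minor⇒model (con ◅ steps) iso = contraction-model con (minor⇒model steps iso)

touched-bound : ∀ {t n} {At : Fin t → Fin n → Set} (At? : ∀ i x → Dec (At i x)) →
  (∀ {i i′} x → At i x → At i′ x → i ≡ i′) → count (λ i → Fin.any? (At? i)) ≤ n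
touched-bound {n = n} At? unique = begin
  count T?                                ≡⟨ *-identityʳ (count T?) ⟨
  count T? * 1                            ≤⟨ double-count At? T? (λ _ → yes tt) 1 (λ i (x , p) → 0<count (At? i) x p) _ unique ⟩
  count {n} (λ _ → yes tt)                ≡⟨ trans (∑-const n 1) (*-identityʳ n) ⟩
  n                                       ∎
  where
  open ≤-Reasoning
  T? = λ i → Fin.any? (At? i)

-- As `n < s * m`, at most `s` classes have `m` or more elements, so `s` of the `s + s` good ones
-- remain. The labelling `ξ` is the form in which `unavoidable-pattern` takes them.
small-classes : ∀ {t n} m s {At : Fin t → Fin n → Set} (At? : ∀ i x → Dec (At i x)) →
  (∀ {i i′} x → At i x → At i′ x → i ≡ i′) →
  {Good : Fin t → Set} (Good? : ∀ i → Dec (Good i)) → s + s ≤ count Good? → n < s * m →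
  Σ (Fin s → Fin t) λ σ → (∀ i → Good (σ i)) ×
  Σ (Fin n → Fin (suc s)) λ ξ → (∀ i x → At (σ i) x → ξ x ≡ suc i) × (∀ i → classSize ξ i ≤ m)
small-classes {t} {n} m s {At} At? unique Good? 2s≤ n<sm =
  let σ , σ-inj , σ-good = choose (λ i → Good? i ×-dec ¬? (large? i)) s≤
      open Labels σ σ-inj
  in σ , (λ i → proj₁ (σ-good i)) , ξ , ξ-complete ,
     λ i → ≤-trans (count-mono (ξ-sound i) (λ x → ξ x Fin.≟ suc i) (At? (σ i))) (<⇒≤ (≰⇒> (proj₂ (σ-good i))))
  where
  large? : ∀ i → Dec (m ≤ count (At? i))
  large? i = m ≤? count (At? i)

  few-large : count large? ≤ s
  few-large = <⇒≤ (*-cancelʳ-< m (count large?) s (≤-<-trans (≤-trans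
    (double-count At? large? (λ _ → yes tt) m (λ _ → id) _ unique)
    (≤-reflexive (trans (∑-const n 1) (*-identityʳ n)))) n<sm))

  s≤ : s ≤ count (λ i → Good? i ×-dec ¬? (large? i))
  s≤ = +-cancelˡ-≤ s _ _ (≤-trans 2s≤ (≤-trans (count-split Good? large?) (+-monoˡ-≤ _ few-large)))

  module Labels (σ : Fin s → Fin t) (σ-inj : Injective _≡_ _≡_ σ) where
    label : ∀ {x} → Dec (∃ λ i → At (σ i) x) → Fin (suc s)
    label (yes (i , _)) = suc i
    label (no _)        = zero

    ξ : Fin n → Fin (suc s)
    ξ x = label (Fin.any? (λ i → At? (σ i) x))

    ξ-sound : ∀ i x → ξ x ≡ suc i → At (σ i) x
    ξ-sound i x eq with Fin.any? (λ i → At? (σ i) x)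
    ξ-sound i x refl | yes (_ , p) = p

    ξ-complete : ∀ i x → At (σ i) x → ξ x ≡ suc i
    ξ-complete i x p with Fin.any? (λ i → At? (σ i) x)
    ... | yes (_ , p′) = cong suc (σ-inj (unique x p′ p))
    ... | no none      = contradiction (i , p) none

-- Blocks of colours

block : ∀ {q} (ks : Vec ℕ q) → Fin (sum ks) → Fin q
block (k ∷ ks) c = [ const zero , suc ∘ block ks ]′ (splitAt k c)

nth : ∀ {q} (ks : Vec ℕ q) i → Fin (lookup ks i) → Fin (sum ks)
nth (k ∷ ks) zero    x = x ↑ˡ sum ks
nth (k ∷ ks) (suc i) x = k ↑ʳ nth ks i x

block-nth : ∀ {q} (ks : Vec ℕ q) i x → block ks (nth ks i x) ≡ i
block-nth (k ∷ ks) zero    x rewrite Fin.splitAt-↑ˡ k x (sum ks) = refl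
block-nth (k ∷ ks) (suc i) x rewrite Fin.splitAt-↑ʳ k (sum ks) (nth ks i x) = cong suc (block-nth ks i x)

nth-injective : ∀ {q} (ks : Vec ℕ q) i → Injective _≡_ _≡_ (nth ks i)
nth-injective (k ∷ ks) zero    eq = Fin.↑ˡ-injective (sum ks) _ _ eq
nth-injective (k ∷ ks) (suc i) eq = nth-injective ks i (Fin.↑ʳ-injective k _ _ eq)

-- One copy of B for every colouring of A

module Pasting (n Q : ℕ) {NonAdj : Fin n → Fin n → Set} (nonAdj? : ∀ b a → Dec (NonAdj b a)) where

  -- inj₁ a is a vertex of the common clique A; inj₂ (z , b) is the vertex b of
  -- the copy of B that belongs to the colouring finToFun z of A.
  Place : Set
  Place = Fin n ⊎ (Fin (Q ^ n) × Fin n)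

  place : Fin (n + Q ^ n * n) → Place
  place = map₂ (remQuot n) ∘ splitAt n

  vertex : Place → Fin (n + Q ^ n * n)
  vertex = join n (Q ^ n * n) ∘ map₂ (λ (z , b) → combine z b)

  place-vertex : ∀ p → place (vertex p) ≡ p
  place-vertex (inj₁ a)       = cong (map₂ (remQuot n)) (Fin.splitAt-join n (Q ^ n * n) (inj₁ a))
  place-vertex (inj₂ (z , b)) = trans (cong (map₂ (remQuot n)) (Fin.splitAt-join n (Q ^ n * n) (inj₂ (combine z b))))
    (cong inj₂ (Fin.remQuot-combine z b))

  vertex-place : ∀ v → vertex (place v) ≡ v
  vertex-place v = trans (cong (join n (Q ^ n * n)) (undo (splitAt n v))) (Fin.join-splitAt n (Q ^ n * n) v)
    where
    undo : ∀ x → map₂ (λ (z , b) → combine z b) (map₂ (remQuot {Q ^ n} n) x) ≡ x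
    undo (inj₁ a) = refl
    undo (inj₂ y) = cong inj₂ (Fin.combine-remQuot {Q ^ n} n y)

  place-injective : Injective _≡_ _≡_ place
  place-injective {u} {v} eq = trans (sym (vertex-place u)) (trans (cong vertex eq) (vertex-place v))

  infix 4 _≟ₚ_
  _≟ₚ_ : (p p′ : Place) → Dec (p ≡ p′)
  _≟ₚ_ = Sum.≡-dec Fin._≟_ (Product.≡-dec Fin._≟_ Fin._≟_)

  Joined : Place → Place → Set
  Joined (inj₁ a)       (inj₁ a′)        = a ≢ a′
  Joined (inj₁ a)       (inj₂ (_ , b))   = ¬ NonAdj b a
  Joined (inj₂ (_ , b)) (inj₁ a)         = ¬ NonAdj b a
  Joined (inj₂ (z , b)) (inj₂ (z′ , b′)) = z ≡ z′ × b ≢ b′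

  joined-sym : ∀ p p′ → Joined p p′ → Joined p′ p
  joined-sym (inj₁ _) (inj₁ _) ne         = ne ∘ sym
  joined-sym (inj₁ _) (inj₂ _) na         = na
  joined-sym (inj₂ _) (inj₁ _) na         = na
  joined-sym (inj₂ _) (inj₂ _) (eq , ne)  = sym eq , ne ∘ sym

  joined-irrefl : ∀ p → ¬ Joined p p
  joined-irrefl (inj₁ _) ne       = ne refl
  joined-irrefl (inj₂ _) (_ , ne) = ne refl

  joined? : ∀ p p′ → Dec (Joined p p′)
  joined? (inj₁ a)       (inj₁ a′)        = ¬? (a Fin.≟ a′)
  joined? (inj₁ a)       (inj₂ (_ , b))   = ¬? (nonAdj? b a)
  joined? (inj₂ (_ , b)) (inj₁ a)         = ¬? (nonAdj? b a)
  joined? (inj₂ (z , b)) (inj₂ (z′ , b′)) = (z Fin.≟ z′) ×-dec ¬? (b Fin.≟ b′)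

  pasted : Graph
  pasted = record
    { order      = n + Q ^ n * n
    ; Adj        = λ u v → Joined (place u) (place v)
    ; adj-sym    = λ {u} {v} → joined-sym (place u) (place v)
    ; adj-irrefl = λ { {u} refl → joined-irrefl (place u) }
    ; adj?       = λ u v → joined? (place u) (place v)
    }

  -- The `n` places of a clique meet at most `n` branch sets, so `s + s` miss it. A branch set
  -- missing `A` and one missing the copy can only be joined by an edge from the copy to `A`, which
  -- a full product of non-edges rules out.
  minor-free : ∀ m s → n < s * m →
    (∀ (η ξ : Fin n → Fin (suc s)) → (∀ j → classSize η j ≤ m) → (∀ i → classSize ξ i ≤ m) →
      ¬ (∀ j i → ¬ (∀ y x → η y ≡ suc j → ξ x ≡ suc i → NonAdj y x))) →
    CliqueMinorFree (n + (s + s)) pasted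
  minor-free m s n<sm unavoidable (H , H′ , sub , steps , iso) =
    -- One branch set missing `A` determines the copy `z` that contains all of them.
    let (f , _ , f-off) = choose offA? {1} (≤-trans 1≤2s many-offA)
        h₀ , h₀≡ = nonempty (f zero)
        z , b₀ , at₀ = off-place h₀ (subst (λ i → ¬ TouchA i) (sym h₀≡) (f-off zero))
    in InCopy.contradicts z h₀ b₀ at₀ (subst (λ i → ¬ TouchA i) (sym h₀≡) (f-off zero))
    where
    t = n + (s + s)
    open CliqueModel (minor⇒model steps iso)
    module S = _⊑_ sub

    at : V H → Place
    at = place ∘ S.embed

    at-injective : Injective _≡_ _≡_ at
    at-injective = S.injective ∘ place-injective

    Occupies : (Fin n → Place) → Fin t → Fin n → Set
    Occupies pt i x = ∃ λ h → branch h ≡ i × at h ≡ pt x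

    occupies? : ∀ pt i x → Dec (Occupies pt i x)
    occupies? pt i x = Fin.any? (λ h → (branch h Fin.≟ i) ×-dec (at h ≟ₚ pt x))

    unique : ∀ pt {i i′} x → Occupies pt i x → Occupies pt i′ x → i ≡ i′
    unique pt x (h , h≡ , ath) (h′ , h′≡ , ath′) =
      trans (sym h≡) (trans (cong branch (at-injective (trans ath (sym ath′)))) h′≡)

    off? : ∀ pt i → Dec (¬ ∃ (Occupies pt i))
    off? pt i = ¬? (Fin.any? (occupies? pt i))

    many-off : ∀ pt → s + s ≤ count (off? pt)
    many-off pt = +-cancelˡ-≤ n _ _ (begin
      n + (s + s)                                  ≡⟨ count-complement (λ i → Fin.any? (occupies? pt i)) ⟨
      count (λ i → Fin.any? (occupies? pt i)) + _  ≤⟨ +-monoˡ-≤ _ (touched-bound (occupies? pt) (unique pt)) ⟩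
      n + count (off? pt)                          ∎)
      where open ≤-Reasoning

    TouchA : Fin t → Set
    TouchA i = ∃ (Occupies inj₁ i)

    offA? : ∀ i → Dec (¬ TouchA i)
    offA? = off? inj₁

    many-offA : s + s ≤ count offA?
    many-offA = many-off inj₁

    1≤2s : 1 ≤ s + s
    1≤2s = ≤-trans (positive s n<sm) (m≤m+n s s)
      where
      positive : ∀ s → n < s * m → 1 ≤ s
      positive (suc _) _ = s≤s z≤n

    off-place : ∀ h → ¬ TouchA (branch h) → ∃₂ λ z b → at h ≡ inj₂ (z , b)
    off-place h off = cases (at h) refl
      where
      cases : ∀ p → at h ≡ p → ∃₂ λ z b → at h ≡ inj₂ (z , b)
      cases (inj₁ a)       eq = contradiction (a , h , refl , eq) off
      cases (inj₂ (z , b)) eq = z , b , eq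

    joined : ∀ {h h′ p p′} → Adj H h h′ → at h ≡ p → at h′ ≡ p′ → Joined p p′
    joined adj refl refl = S.adj-pres adj

    module InCopy (z : Fin (Q ^ n)) where
      B : Fin n → Place
      B b = inj₂ (z , b)

      InB : V H → Set
      InB h = ∃ λ b → at h ≡ B b

      neighbour : ∀ {h h′} → Adj H h h′ → InB h → ¬ TouchA (branch h′) → InB h′
      neighbour {h} {h′} adj (b , ath) off
        with z′ , b′ , ath′ ← off-place h′ off
        with refl , _ ← joined adj ath ath′ = b′ , ath′

      along : ∀ {h h′} → Star (λ x y → Adj H x y × branch x ≡ branch y) h h′ →
        ¬ TouchA (branch h) → InB h → InB h′
      along stop                   off inB = inB
      along ((adj , same) ◅ path) off inB =
        let off′ = subst (λ i → ¬ TouchA i) same off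
        in along path off′ (neighbour adj inB off′)

      contradicts : ∀ h₀ b₀ → at h₀ ≡ B b₀ → ¬ TouchA (branch h₀) → ⊥
      contradicts h₀ b₀ at₀ off₀ =
        let ρ , ρ-off , η , η-label , η-small = small-classes m s (occupies? B) (unique B) offA? many-offA n<sm
            σ , σ-off , ξ , ξ-label , ξ-small = small-classes m s (occupies? inj₁) (unique inj₁) (off? B) (many-off B) n<sm
        in unavoidable η ξ η-small ξ-small λ j i nonAdj →
           edge (ρ-off j) (σ-off i) λ {y} {x} occ-y occ-x → nonAdj y x (η-label j y occ-y) (ξ-label i x occ-x)
        where
        -- From `h₀` one walks inside its branch set, crosses an edge to branch set `i` and walks
        -- on; without entering `A` the copy cannot be left.
        off⇒InB : ∀ {i} → ¬ TouchA i → ∀ h → branch h ≡ i → InB h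
        off⇒InB {i} off h refl with branch h₀ Fin.≟ i
        ... | yes same = along (connected same) off₀ (b₀ , at₀)
        ... | no ne with x , y , x≡ , y≡ , adj ← adjacent ne =
          let inB-x = along (connected (sym x≡)) off₀ (b₀ , at₀)
              off-y = subst (λ i → ¬ TouchA i) (sym y≡) off
          in along (connected y≡) off-y (neighbour adj inB-x off-y)

        edge : ∀ {i j} → ¬ TouchA j → ¬ ∃ (Occupies B i) →
          ¬ (∀ {y x} → Occupies B j y → Occupies inj₁ i x → NonAdj y x)
        edge {i} {j} offA offB nonAdj =
          let h , h′ , h≡ , h′≡ , adj = adjacent j≢i
              y , ath = off⇒InB offA h h≡
          in cases h′ h′≡ (λ {p′} → joined {p′ = p′} adj ath) (h , h≡ , ath) (at h′) refl
          where
          -- A nonempty set inside the copy cannot miss the copy.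
          j≢i : j ≢ i
          j≢i refl = let h , h≡ = nonempty j
                         b , ath = off⇒InB offA h h≡
                     in offB (b , h , h≡ , ath)
          cases : ∀ h′ → branch h′ ≡ i → ∀ {y} → (∀ {p′} → at h′ ≡ p′ → Joined (B y) p′) →
            Occupies B j y → ∀ p → at h′ ≡ p → ⊥
          cases h′ h′≡ adj occ (inj₁ x) eq = adj eq (nonAdj occ (h′ , h′≡ , eq))
          cases h′ h′≡ adj occ (inj₂ (z′ , b)) eq with refl , _ ← adj eq = offB (b , h′ , h′≡ , eq)

-- Lists that admit no colouring

module ListColouring {q} (n d : ℕ) (ks : Vec ℕ q)
  {NonAdj : Fin n → Fin n → Set} (nonAdj? : ∀ b a → Dec (NonAdj b a))
  (sparse : ∀ b → count (nonAdj? b) ≤ d) where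

  ks⁺ : Vec ℕ q
  ks⁺ = map (_+ d) ks

  Q : ℕ
  Q = sum ks⁺

  open Pasting n Q nonAdj?

  -- The non-neighbour `a` is kept as an index, so that forbidden colours can be counted by their
  -- witnesses.
  Forbidden : Place → Fin n → Fin Q → Set
  Forbidden (inj₁ _)       a c = ⊥
  Forbidden (inj₂ (z , b)) a c = NonAdj b a × finToFun z a ≡ c

  forbidden? : ∀ p a c → Dec (Forbidden p a c)
  forbidden? (inj₁ _)       a c = no λ ()
  forbidden? (inj₂ (z , b)) a c = nonAdj? b a ×-dec (finToFun z a Fin.≟ c)

  lists : ListAssignment pasted (Fin Q)
  lists v c = ¬ ∃ λ a → Forbidden (place v) a c

  -- Each non-neighbour of `b` forbids a single colour, the one that `z` gives it. The injection `f`
  -- will enumerate one block.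
  few-forbidden : ∀ p {k} (f : Fin k → Fin Q) → Injective _≡_ _≡_ f →
    count (λ x → Fin.any? (λ a → forbidden? p a (f x))) ≤ d
  few-forbidden (inj₁ a₁) f f-inj = ≤-trans
    (≤-reflexive (count-none (λ x → Fin.any? (λ a → forbidden? (inj₁ a₁) a (f x))) (λ { _ (_ , ()) }))) z≤n
  few-forbidden (inj₂ (z , b)) f f-inj = begin
    count bad?               ≡⟨ *-identityʳ (count bad?) ⟨
    count bad? * 1           ≤⟨ double-count R? bad? (nonAdj? b) 1 (λ x (a , p) → 0<count (R? x) a p)
                                  (λ _ _ → proj₁) (λ _ (_ , p) (_ , p′) → f-inj (trans (sym p) p′)) ⟩
    count (nonAdj? b)        ≤⟨ sparse b ⟩
    d                        ∎
    where
    open ≤-Reasoning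
    R? = λ x a → forbidden? (inj₂ (z , b)) a (f x)
    bad? = λ x → Fin.any? (R? x)

  large-lists : ∀ i v → AtLeast (lookup ks i) (lists v ∩ λ c → block ks⁺ c ≡ i)
  large-lists i v =
    let f , f-inj , f-good = choose (¬? ∘ bad?) enough
    in nth ks⁺ i ∘ f , f-inj ∘ nth-injective ks⁺ i , λ x → f-good x , block-nth ks⁺ i (f x)
    where
    bad? = λ x → Fin.any? (λ a → forbidden? (place v) a (nth ks⁺ i x))
    enough : lookup ks i ≤ count (¬? ∘ bad?)
    enough = +-cancelˡ-≤ d _ _ (begin
      d + lookup ks i                ≡⟨ +-comm d _ ⟩
      lookup ks i + d                ≡⟨ lookup-map i (_+ d) ks ⟨
      lookup ks⁺ i                   ≡⟨ count-complement bad? ⟨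
      count bad? + count (¬? ∘ bad?) ≤⟨ +-monoˡ-≤ _ (few-forbidden (place v) (nth ks⁺ i) (nth-injective ks⁺ i)) ⟩
      d + count (¬? ∘ bad?)          ∎)
      where open ≤-Reasoning

  no-colouring : Q < n + n → ¬ Colouring pasted lists
  no-colouring Q<2n colouring = <⇒≱ Q<2n (Fin.injective⇒≤ both-injective)
    where
    open Colouring colouring

    hue : Place → Fin Q
    hue = colour ∘ vertex

    -- The copy belonging to the colouring induced on `A`.
    z : Fin (Q ^ n)
    z = funToFin (hue ∘ inj₁)

    both : Fin n ⊎ Fin n → Place
    both (inj₁ a) = inj₁ a
    both (inj₂ b) = inj₂ (z , b)

    different : ∀ p p′ → Joined p p′ → hue p ≢ hue p′
    different p p′ pp′ = proper (subst₂ Joined (sym (place-vertex p)) (sym (place-vertex p′)) pp′)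

    separate : ∀ a b → hue (inj₁ a) ≢ hue (inj₂ (z , b))
    -- Adjacent vertices differ by properness, non-adjacent ones by the choice of the lists.
    separate a b eq with nonAdj? b a
    ... | no na  = different (inj₁ a) (inj₂ (z , b)) na eq
    ... | yes na = inList (vertex (inj₂ (z , b))) (a , subst (λ p → Forbidden p a (hue (inj₂ (z , b))))
                     (sym (place-vertex (inj₂ (z , b)))) (na , trans (Fin.finToFun-funToFin (hue ∘ inj₁) a) eq))

    hue-injective : ∀ x x′ → hue (both x) ≡ hue (both x′) → x ≡ x′
    hue-injective (inj₁ a) (inj₂ b)  eq = contradiction eq (separate a b)
    hue-injective (inj₂ b) (inj₁ a)  eq = contradiction (sym eq) (separate a b)
    hue-injective (inj₁ a) (inj₁ a′) eq with a Fin.≟ a′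
    ... | yes refl = refl
    ... | no ne    = contradiction eq (different (inj₁ a) (inj₁ a′) ne)
    hue-injective (inj₂ b) (inj₂ b′) eq with b Fin.≟ b′
    ... | yes refl = refl
    ... | no ne    = contradiction eq (different (inj₂ (z , b)) (inj₂ (z , b′)) (refl , ne))

    both-injective : Injective _≡_ _≡_ (λ (i : Fin (n + n)) → hue (both (splitAt n i)))
    both-injective {i} {j} eq = trans (sym (Fin.join-splitAt n n i))
      (trans (cong (join n n) (hue-injective (splitAt n i) (splitAt n j) eq)) (Fin.join-splitAt n n j))

  not-choosable : Fin n → Q < n + n → ¬ Choosable ks pasted
  not-choosable a₀ Q<2n choosable = no-colouring Q<2n (choosable lists
    ( (λ i c → block ks⁺ c ≡ i)
    -- Vertices of `A` have full lists, so `a₀` shows that every colour occurs.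
    , record { within   = λ i {c} _ → vertex (inj₁ a₀) , full c
             ; covers   = λ {c} _ → block ks⁺ c , refl
             ; disjoint = λ i≢j c (p , p′) → i≢j (trans (sym p) p′) }
    , large-lists))
    where
    full : ∀ c → lists (vertex (inj₁ a₀)) c
    full c (a , forb) = subst (λ p → Forbidden p a c) (place-vertex (inj₁ a₀)) forb

-- From the real bound to an integral one

private
  ι : ℕ → ℚ
  ι n = ℤ.+ n ℚ./ 1

  toℚᵘ-ι : ∀ n → toℚᵘ (ι n) ℚᵘ.≃ mkℚᵘ (ℤ.+ n) 0
  toℚᵘ-ι n = ℚ.toℚᵘ-fromℚᵘ (mkℚᵘ (ℤ.+ n) 0)

  ι-+ : ∀ a b → ι (a + b) ≡ ι a ℚ.+ ι b
  ι-+ a b = ℚ.toℚᵘ-injective (ℚᵘ.≃-trans (toℚᵘ-ι (a + b)) (ℚᵘ.≃-trans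
    (*≡* (cong (ℤ._* ℤ.+ 1) (sym (cong₂ ℤ._+_ (ℤ.*-identityʳ (ℤ.+ a)) (ℤ.*-identityʳ (ℤ.+ b))))))
    (ℚᵘ.≃-sym (ℚᵘ.≃-trans (ℚ.toℚᵘ-homo-+ (ι a) (ι b)) (ℚᵘ.+-cong (toℚᵘ-ι a) (toℚᵘ-ι b))))))

  ι-* : ∀ a b → ι (a * b) ≡ ι a ℚ.* ι b
  ι-* a b = ℚ.toℚᵘ-injective (ℚᵘ.≃-trans (toℚᵘ-ι (a * b)) (ℚᵘ.≃-trans
    (*≡* (cong (ℤ._* ℤ.+ 1) (ℤ.pos-* a b)))
    (ℚᵘ.≃-sym (ℚᵘ.≃-trans (ℚ.toℚᵘ-homo-* (ι a) (ι b)) (ℚᵘ.*-cong (toℚᵘ-ι a) (toℚᵘ-ι b))))))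

  ι-mono : ∀ {a b} → a ≤ b → ι a ℚ.≤ ι b
  ι-mono {a} {b} a≤b = ℚ.toℚᵘ-cancel-≤ (ℚᵘ.≤-respˡ-≃ (ℚᵘ.≃-sym (toℚᵘ-ι a)) (ℚᵘ.≤-respʳ-≃ (ℚᵘ.≃-sym (toℚᵘ-ι b))
    (*≤* (ℤ.*-monoʳ-≤-nonNeg (ℤ.+ 1) (ℤ.+≤+ a≤b)))))

  -- The denominator of `δ` serves, since the numerator is at least 1.
  unit-fraction : ∀ δ → 0ℚ ℚ.< δ → ∃₂ λ k x → 0ℚ ℚ.< x × x ℚ.≤ δ × x ℚ.* ι (suc k) ≡ 1ℚ
  unit-fraction (mkℚ (ℤ.+ zero) k _) (ℚ.*<* (ℤ.+<+ ()))
  unit-fraction (mkℚ (ℤ.-[1+ _ ]) k _) (ℚ.*<* ())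
  unit-fraction δ@(mkℚ (ℤ.+ suc p) k _) 0<δ = k , x , 0<x , x≤δ , inverse
    where
    x = fromℚᵘ (mkℚᵘ (ℤ.+ 1) k)
    x≃ : toℚᵘ x ℚᵘ.≃ mkℚᵘ (ℤ.+ 1) k
    x≃ = ℚ.toℚᵘ-fromℚᵘ (mkℚᵘ (ℤ.+ 1) k)
    0<x : 0ℚ ℚ.< x
    0<x = ℚ.toℚᵘ-cancel-< (ℚᵘ.<-respʳ-≃ (ℚᵘ.≃-sym x≃) (ℚᵘ.positive⁻¹ (mkℚᵘ (ℤ.+ 1) k)))
    x≤δ : x ℚ.≤ δ
    x≤δ = ℚ.toℚᵘ-cancel-≤ (ℚᵘ.≤-respˡ-≃ (ℚᵘ.≃-sym x≃)
      (*≤* (ℤ.*-monoʳ-≤-nonNeg (ℤ.+ suc k) (ℤ.+≤+ (s≤s (z≤n {p}))))))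
    inverse : x ℚ.* ι (suc k) ≡ 1ℚ
    inverse = ℚ.toℚᵘ-injective (ℚᵘ.≃-trans (ℚ.toℚᵘ-homo-* x (ι (suc k)))
      (ℚᵘ.≃-trans (ℚᵘ.*-cong x≃ (toℚᵘ-ι (suc k))) (*≡* (swap (ℤ.+ suc k)))))
      where
      swap : ∀ i → ℤ.+ 1 ℤ.* i ℤ.* ℤ.+ 1 ≡ ℤ.+ 1 ℤ.* (i ℤ.* ℤ.+ 1)
      swap i = ℤ.*-assoc (ℤ.+ 1) i (ℤ.+ 1)

-- A unit fraction `1 / suc k` eventually below `ε` replaces it. If the integral bound failed, it
-- would fail by at least 1; dividing by `suc k` leaves a fixed gap that contradicts the real bound.
integral-bound : ∀ ε → fromℕ 0 <ᴿ ε →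
  ∃ λ k → ∀ S t → fromℕ S ≤ᴿ (fromℕ 2 -ᴿ ε) *ᴿ fromℕ t → suc k * S + t ≤ 2 * (suc k * t)
integral-bound ε (δ , 0<δ , N , δ≤) with unit-fraction δ 0<δ
... | k , x , 0<x , x≤δ , x*E≡1 = k , λ S t S≤ → ≮⇒≥ λ big → S≤ (x , 0<x , N , λ n N≤n → gap S t big (seq ε n) (below n N≤n))
  where
  E = suc k

  below : ∀ n → N ≤ n → x ℚ.≤ seq ε n
  below n N≤n = ℚ.≤-trans x≤δ (ℚ.≤-trans (ℚ.≤-reflexive (sym (ℚ.+-identityˡ δ))) (δ≤ n N≤n))

  open ℚ.≤-Reasoning

  gap : ∀ S t → 2 * (E * t) < E * S + t → ∀ e → x ℚ.≤ e → (ι 2 ℚ.- e) ℚ.* ι t ℚ.+ x ℚ.≤ ι S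
  gap S t big e x≤e = begin
    (ι 2 ℚ.- e) ℚ.* ι t ℚ.+ x
      ≤⟨ ℚ.+-monoˡ-≤ x (ℚ.*-monoʳ-≤-nonNeg (ι t) {{ℚ.nonNegative (ι-mono {0} {t} z≤n)}} (ℚ.+-monoʳ-≤ (ι 2) (ℚ.neg-antimono-≤ x≤e))) ⟩
    (ι 2 ℚ.- x) ℚ.* ι t ℚ.+ x
      ≡⟨ solve 3 (λ d x t → (d :- x) :* t :+ x := (d :* t :+ x) :- x :* t) refl (ι 2) x (ι t) ⟩
    (ι 2 ℚ.* ι t ℚ.+ x) ℚ.- x ℚ.* ι t
      ≡⟨ cong (ℚ._- x ℚ.* ι t) left ⟩
    x ℚ.* ι (suc (2 * (E * t))) ℚ.- x ℚ.* ι t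
      ≤⟨ ℚ.+-monoˡ-≤ (ℚ.- (x ℚ.* ι t)) (ℚ.*-monoˡ-≤-nonNeg x {{ℚ.nonNegative (ℚ.<⇒≤ 0<x)}} (ι-mono big)) ⟩
    x ℚ.* ι (E * S + t) ℚ.- x ℚ.* ι t
      ≡⟨ cong (ℚ._- x ℚ.* ι t) right ⟩
    (ι S ℚ.+ x ℚ.* ι t) ℚ.- x ℚ.* ι t
      ≡⟨ solve 2 (λ s y → (s :+ y) :- y := s) refl (ι S) (x ℚ.* ι t) ⟩
    ι S ∎
    where
    open +-*-Solver

    cancel : ∀ y → x ℚ.* (ι E ℚ.* y) ≡ y
    cancel y = trans (sym (ℚ.*-assoc x (ι E) y)) (trans (cong (ℚ._* y) x*E≡1) (ℚ.*-identityˡ y))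

    left : ι 2 ℚ.* ι t ℚ.+ x ≡ x ℚ.* ι (suc (2 * (E * t)))
    left = sym (begin-equality
      x ℚ.* ι (1 + 2 * (E * t))
        ≡⟨ cong (x ℚ.*_) (trans (ι-+ 1 (2 * (E * t))) (cong (1ℚ ℚ.+_) (trans (ι-* 2 (E * t)) (cong (ι 2 ℚ.*_) (ι-* E t))))) ⟩
      x ℚ.* (1ℚ ℚ.+ ι 2 ℚ.* (ι E ℚ.* ι t))
        ≡⟨ solve 4 (λ x d e t → x :* (con 1ℚ :+ d :* (e :* t)) := d :* (x :* (e :* t)) :+ x) refl x (ι 2) (ι E) (ι t) ⟩
      ι 2 ℚ.* (x ℚ.* (ι E ℚ.* ι t)) ℚ.+ x
        ≡⟨ cong (λ y → ι 2 ℚ.* y ℚ.+ x) (cancel (ι t)) ⟩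
      ι 2 ℚ.* ι t ℚ.+ x ∎)

    right : x ℚ.* ι (E * S + t) ≡ ι S ℚ.+ x ℚ.* ι t
    right = begin-equality
      x ℚ.* ι (E * S + t)                      ≡⟨ cong (x ℚ.*_) (trans (ι-+ (E * S) t) (cong (ℚ._+ ι t) (ι-* E S))) ⟩
      x ℚ.* (ι E ℚ.* ι S ℚ.+ ι t)              ≡⟨ ℚ.*-distribˡ-+ x (ι E ℚ.* ι S) (ι t) ⟩
      x ℚ.* (ι E ℚ.* ι S) ℚ.+ x ℚ.* ι t        ≡⟨ cong (ℚ._+ x ℚ.* ι t) (cancel (ι S)) ⟩
      ι S ℚ.+ x ℚ.* ι t                        ∎

-- Choice of the parameters

sum-map-+ : ∀ {q} (ks : Vec ℕ q) d → sum (map (_+ d) ks) ≡ sum ks + q * d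
sum-map-+ []       d = refl
sum-map-+ {suc q} (k ∷ ks) d = trans (cong (k + d +_) (sum-map-+ ks d)) (shuffle k d (sum ks) (q * d))
  where
  shuffle : ∀ k d S r → k + d + (S + r) ≡ k + S + (d + r)
  shuffle = solve-∀

-- With `t = n + 2s`, the hypothesis leaves a margin of `t / E` below `2t`. In units of `t / (8E)`
-- this margin is 8, of which `2t - 2n = 4s` takes at most 4, the padding `q * d` at most 2 and
-- strictness at most 1.
colour-bound : ∀ E .{{_ : NonZero E}} q S d n s → E * S + (n + (s + s)) ≤ 2 * (E * (n + (s + s))) →
  d * (4 * E * q) ≤ n → s * (8 * E) ≤ n + (s + s) → 1 ≤ s → S + q * d < n + n
colour-bound E q S d n s S≤ d≤ s≤ 1≤s = *-cancelˡ-≤ (8 * E) {{m*n≢0 8 E}} (+-cancelʳ-≤ (8 * t) _ _ (begin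
  8 * E * suc (S + q * d) + 8 * t                        ≡⟨ lhs E S q d t ⟩
  8 * (E * S + t) + 2 * (d * (4 * E * q)) + 1 * (8 * E)  ≤⟨ +-mono-≤ (+-mono-≤ (*-monoʳ-≤ 8 S≤) (*-monoʳ-≤ 2 (≤-trans d≤ (m≤m+n n (s + s))))) (≤-trans (*-monoˡ-≤ (8 * E) 1≤s) s≤) ⟩
  8 * (2 * (E * t)) + 2 * t + t                          ≡⟨ middle E n s ⟩
  8 * E * (n + n) + 4 * (s * (8 * E)) + 3 * t            ≤⟨ +-monoˡ-≤ (3 * t) (+-monoʳ-≤ (8 * E * (n + n)) (*-monoʳ-≤ 4 s≤)) ⟩
  8 * E * (n + n) + 4 * t + 3 * t                        ≤⟨ m≤m+n _ t ⟩
  8 * E * (n + n) + 4 * t + 3 * t + t                    ≡⟨ collect (8 * E * (n + n)) t ⟩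
  8 * E * (n + n) + 8 * t                                ∎))
  where
  open ≤-Reasoning
  t = n + (s + s)
  lhs : ∀ E S q d t → 8 * E * suc (S + q * d) + 8 * t ≡ 8 * (E * S + t) + 2 * (d * (4 * E * q)) + 1 * (8 * E)
  lhs = solve-∀
  middle : ∀ E n s → 8 * (2 * (E * (n + (s + s)))) + 2 * (n + (s + s)) + (n + (s + s)) ≡ 8 * E * (n + n) + 4 * (s * (8 * E)) + 3 * (n + (s + s))
  middle = solve-∀
  collect : ∀ x t → x + 4 * t + 3 * t + t ≡ x + 8 * t
  collect = solve-∀

construction : ∀ {q} k m n s (ks : Vec ℕ q) →
  suc k ^ n * (suc s ^ n * suc s ^ n) * (suc k ^ (m * m) ∸ 1) ^ (s * s) < (suc k ^ (m * m)) ^ (s * s) →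
  n < s * m → sum ks + q * (n / suc k) < n + n →
  Σ Graph λ G → CliqueMinorFree (n + (s + s)) G × ¬ Choosable ks G
construction k m n s ks Z< n<sm few-colours with v , unavoidable ← unavoidable-pattern k m s n Z< =
  pasted , minor-free m s n<sm (unavoidable κ) , not-choosable (inhabitant n Q<2n) Q<2n
  where
  d = n / suc k

  κ : Fin n → Fin (suc k)
  κ b = proj₁ (rare-value (v b))

  nonAdj? : ∀ b a → Dec (v b a ≡ κ b)
  nonAdj? b a = v b a Fin.≟ κ b

  sparse : ∀ b → count (nonAdj? b) ≤ d
  sparse b = ≤-trans (≤-reflexive (sym (m*n/n≡m (count (nonAdj? b)) (suc k))))
    (/-monoˡ-≤ (suc k) (≤-trans (≤-reflexive (*-comm (count (nonAdj? b)) (suc k))) (proj₂ (rare-value (v b)))))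

  open ListColouring n d ks nonAdj? sparse
  open Pasting n Q nonAdj?

  Q<2n : Q < n + n
  Q<2n = ≤-<-trans (≤-reflexive (sum-map-+ ks d)) few-colours

  inhabitant : ∀ n {Q} → Q < n + n → Fin n
  inhabitant (suc _) _ = zero

-- The parameters are `s = t / (8E)`, rounded down, and `n = t - 2s`. Using `4Eq` pattern values
-- keeps `q * d` at most `n / (4E)`, and `m = 16E` gives `t < s * m`.
integral-theorem : ∀ E .{{_ : NonZero E}} q k m → suc k ≡ 4 * E * q → m ≡ 16 * E → 1 ≤ q →
  ∃ λ t₃ → ∀ t → t₃ ≤ t → (ks : Vec ℕ q) → E * sum ks + t ≤ 2 * (E * t) →
  Σ Graph λ G → CliqueMinorFree t G × ¬ Choosable ks G
integral-theorem E q k m k≡ m≡ 1≤q = suc s₀ * D , λ t t₃≤t ks → for-quotient t (t / D)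
    (≤-trans (≤-reflexive (sym (m*n/n≡m (suc s₀) D))) (/-monoˡ-≤ D t₃≤t))
    (m/n*n≤m t D)
    (≤-<-trans (≤-reflexive (m≡m%n+[m/n]*n t D)) (+-monoˡ-< (t / D * D) (m%n<n t D)))
    ks
  where
  open ≤-Reasoning

  D = 8 * E

  instance
    D≢0 : NonZero D
    D≢0 = m*n≢0 8 E

  1≤E : 1 ≤ E
  1≤E = >-nonZero⁻¹ E

  2≤P : 2 ≤ suc k ^ (m * m)
  2≤P = begin
    2                    ≤⟨ s≤s (*-mono-≤ 1≤m 1≤m) ⟩
    suc (m * m)          ≤⟨ n<2^n (m * m) ⟩
    2 ^ (m * m)          ≤⟨ ^-monoˡ-≤ (m * m) 2≤1+k ⟩
    suc k ^ (m * m)      ∎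
    where
    1≤m : 1 ≤ m
    1≤m = ≤-trans (*-mono-≤ {1} {16} {1} {E} (s≤s z≤n) 1≤E) (≤-reflexive (sym m≡))
    2≤1+k : 2 ≤ suc k
    2≤1+k = ≤-trans (*-mono-≤ {2} {4 * E} {1} {q} (*-mono-≤ {2} {4} {1} {E} (s≤s (s≤s z≤n)) 1≤E) 1≤q)
      (≤-reflexive (sym k≡))

  large-s : ∃ λ s₀ → ∀ s → s₀ ≤ s → ∀ n → n ≤ m * s →
    suc k ^ n * (suc s ^ n * suc s ^ n) * (suc k ^ (m * m) ∸ 1) ^ (s * s) < (suc k ^ (m * m)) ^ (s * s)
  large-s = union-bound (suc k) (suc k ^ (m * m)) m 2≤P

  s₀ : ℕ
  s₀ = proj₁ large-s

  for-quotient : ∀ t s → s₀ < s → s * D ≤ t → t < suc s * D → (ks : Vec ℕ q) →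
    E * sum ks + t ≤ 2 * (E * t) → Σ Graph λ G → CliqueMinorFree t G × ¬ Choosable ks G
  for-quotient t s s₀<s s≤ <s ks ks≤ = go (t ∸ (s + s)) (m∸n+n≡m 2s≤t) s≤ ks≤
    where
    1≤s : 1 ≤ s
    1≤s = ≤-trans (s≤s z≤n) s₀<s

    2s≤t : s + s ≤ t
    2s≤t = begin
      s + s    ≡⟨ double s ⟩
      s * 2    ≤⟨ *-monoʳ-≤ s (*-mono-≤ {2} {8} {1} {E} (s≤s (s≤s z≤n)) 1≤E) ⟩
      s * D    ≤⟨ s≤ ⟩
      t        ∎
      where
      double : ∀ s → s + s ≡ s * 2
      double = solve-∀

    t<sm : t < s * m
    t<sm = begin-strict
      t               <⟨ <s ⟩
      D + s * D       ≡⟨ cong (_+ s * D) (*-identityˡ D) ⟨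
      1 * D + s * D   ≤⟨ +-monoˡ-≤ (s * D) (*-monoˡ-≤ D 1≤s) ⟩
      s * D + s * D   ≡⟨ collect s E ⟩
      s * (16 * E)    ≡⟨ cong (s *_) m≡ ⟨
      s * m           ∎
      where
      collect : ∀ s E → s * (8 * E) + s * (8 * E) ≡ s * (16 * E)
      collect = solve-∀

    go : ∀ n → n + (s + s) ≡ t → s * D ≤ t → E * sum ks + t ≤ 2 * (E * t) →
      Σ Graph λ G → CliqueMinorFree t G × ¬ Choosable ks G
    go n refl s≤ ks≤ = construction k m n s ks
      (proj₂ large-s s (<⇒≤ s₀<s) n (≤-trans (<⇒≤ n<sm) (≤-reflexive (*-comm s m))))
      n<sm
      (colour-bound E q (sum ks) (n / suc k) n s ks≤ (≤-trans (≤-reflexive (cong (n / suc k *_) (sym k≡))) (m/n*n≤m n (suc k))) s≤ 1≤s)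
      where
      n<sm : n < s * m
      n<sm = ≤-<-trans (m≤m+n n (s + s)) t<sm

theorem4 : (ε : ℝ) → fromℕ 0 <ᴿ ε → ε <ᴿ fromℕ 1 →
    (q : ℕ) → 1 ≤ q →
    Σ ℕ λ t₃ → (t : ℕ) → t₃ ≤ t →
    (ks : Vec ℕ q) → All (1 ≤_) ks →
    fromℕ (sum ks) ≤ᴿ (fromℕ 2 -ᴿ ε) *ᴿ fromℕ t →
    Σ Graph λ G → CliqueMinorFree t G × ¬ Choosable ks G
theorem4 ε 0<ε _ q 1≤q =
  proj₁ large , λ t t₃≤t ks _ ks≤ → proj₂ large t t₃≤t ks (proj₂ (integral-bound ε 0<ε) (sum ks) t ks≤)
  where
  E = suc (proj₁ (integral-bound ε 0<ε))

  large : ∃ λ t₃ → ∀ t → t₃ ≤ t → (ks : Vec ℕ q) → E * sum ks + t ≤ 2 * (E * t) →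
    Σ Graph λ G → CliqueMinorFree t G × ¬ Choosable ks G
  large = integral-theorem E q (pred (4 * E * q)) (16 * E)
    (suc-pred (4 * E * q) {{m*n≢0 (4 * E) q {{_}} {{>-nonZero 1≤q}}}}) refl 1≤q
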